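{- For every integer $n \geq 1$ and every real $x$, $$\frac{\widehat{c}_n(x)}{n!} = \binom{x}{n} + \sum_{m=0}^{n-1} \frac{\widehat{c}_m(x)}{m!}\, \frac{(-1)^{n-m}}{(n-m)(n+1-m)}.$$
   Context: For real $z$ and integer $n\ge 0$, $\binom{z}{n} = \frac{z(z-1)\cdots(z-n+1)}{n!}$ (with $\binom{z}{0}=1$). The Cauchy polynomials of the second kind are $\widehat{c}_n(x) = n! \int_{0}^{1} \binom{x - t}{n}\, dt$ for $n \ge 0$ (equivalently, $\frac{t(1+t)^x}{(1+t)\ln(1+t)} = \sum_{n\ge 0} \widehat{c}_n(x)\frac{t^n}{n!}$ for $|t|<1$). -}

module Defs where

open import Algebra.Bundles using (CommutativeRing)
import Algebra.Solver.Ring as RingSolver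
import Algebra.Solver.Ring.AlmostCommutativeRing as ACR
import Data.Fin.Properties as Fin
open import Data.Fin.Base as Fin using (Fin; zero; suc; toℕ; inject₁)
open import Data.Integer.Base as ℤ using (+_)
open import Data.Maybe.Base using (Maybe; just; nothing)
open import Data.Nat.Base as ℕ using (ℕ; zero; suc; _∸_; _!)
import Data.Nat.Properties as ℕ
open import Data.Nat.Properties using (_!≢0)
open import Data.Product using (∃; _×_; _,_; proj₁; proj₂)
open import Data.Rational as ℚ using (ℚ; 0ℚ; 1ℚ; ½)
import Data.Rational.Properties as ℚ
import Data.Rational.Solver as ℚ
open import Data.Sum.Base using (inj₁; inj₂)
open import Level using (0ℓ)
open import Relation.Binary.PropositionalEquality as ≡ using (_≡_)
open import Relation.Nullary using (yes; no)

private
  module ℚ-Solver = ℚ.+-*-Solver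

  ½-pos : ∀ {ε} → 0ℚ ℚ.< ε → 0ℚ ℚ.< ½ ℚ.* ε
  ½-pos {ε} ε>0 = ℚ.positive⁻¹ (½ ℚ.* ε) {{ℚ.pos*pos⇒pos ½ ε {{ℚ.positive ε>0}}}}

  ½+½ : ∀ ε → ½ ℚ.* ε ℚ.+ ½ ℚ.* ε ≡ ε
  ½+½ ε = ≡.trans (≡.sym (ℚ.*-distribʳ-+ ε ½ ½)) (ℚ.*-identityˡ ε)

  1>0 : 0ℚ ℚ.< 1ℚ
  1>0 = ℚ.positive⁻¹ 1ℚ

  divide : ∀ {ε B} → 0ℚ ℚ.< ε → 0ℚ ℚ.< B → ∃ λ δ → 0ℚ ℚ.< δ × B ℚ.* δ ≡ ε
  divide {ε} {B} ε>0 B>0 =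
    1/B ℚ.* ε
    , ℚ.positive⁻¹ _ {{ℚ.pos*pos⇒pos 1/B {{ℚ.1/pos⇒pos B}} ε {{ℚ.positive ε>0}}}}
    , ≡.trans (≡.sym (ℚ.*-assoc B 1/B ε))
        (≡.trans (≡.cong (ℚ._* ε) (ℚ.*-inverseʳ B)) (ℚ.*-identityˡ ε))
    where
    instance
      _ = ℚ.positive B>0
      _ = ℚ.pos⇒nonZero B {{ℚ.positive B>0}}
    1/B = ℚ.1/ B

  ∣+∣≤ : ∀ p q {a b} → ℚ.∣ p ∣ ℚ.≤ a → ℚ.∣ q ∣ ℚ.≤ b → ℚ.∣ p ℚ.+ q ∣ ℚ.≤ a ℚ.+ b
  ∣+∣≤ p q p≤a q≤b = ℚ.≤-trans (ℚ.∣p+q∣≤∣p∣+∣q∣ p q) (ℚ.+-mono-≤ p≤a q≤b)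

  *-mono-≤ : ∀ {p q a b} → 0ℚ ℚ.≤ p → 0ℚ ℚ.≤ b → p ℚ.≤ a → q ℚ.≤ b → p ℚ.* q ℚ.≤ a ℚ.* b
  *-mono-≤ {p} {q} {a} {b} 0≤p 0≤b p≤a q≤b = ℚ.≤-trans
    (ℚ.*-monoˡ-≤-nonNeg p {{ℚ.nonNegative 0≤p}} q≤b)
    (ℚ.*-monoʳ-≤-nonNeg b {{ℚ.nonNegative 0≤b}} p≤a)

  ∣*∣≤ : ∀ p q {a b} → ℚ.∣ p ∣ ℚ.≤ a → ℚ.∣ q ∣ ℚ.≤ b → ℚ.∣ p ℚ.* q ∣ ℚ.≤ a ℚ.* b
  ∣*∣≤ p q {a} {b} p≤a q≤b = ≡.subst (ℚ._≤ a ℚ.* b) (≡.sym (ℚ.∣p*q∣≡∣p∣*∣q∣ p q))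
    (*-mono-≤ (ℚ.0≤∣p∣ p) (ℚ.≤-trans (ℚ.0≤∣p∣ q) q≤b) p≤a q≤b)

  ∣∣≤ : ∀ p {a} → p ℚ.≤ a → ℚ.- p ℚ.≤ a → ℚ.∣ p ∣ ℚ.≤ a
  ∣∣≤ p {a} p≤a -p≤a with ℚ.∣p∣≡p∨∣p∣≡-p p
  ... | inj₁ e = ≡.subst (ℚ._≤ a) (≡.sym e) p≤a
  ... | inj₂ e = ≡.subst (ℚ._≤ a) (≡.sym e) -p≤a

  p≤∣p∣ : ∀ p → p ℚ.≤ ℚ.∣ p ∣
  p≤∣p∣ p with ℚ.≤-total 0ℚ p
  ... | inj₁ 0≤p = ℚ.≤-reflexive (≡.sym (ℚ.0≤p⇒∣p∣≡p 0≤p))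
  ... | inj₂ p≤0 = ℚ.≤-trans p≤0 (ℚ.0≤∣p∣ p)

  -p≤∣p∣ : ∀ p → ℚ.- p ℚ.≤ ℚ.∣ p ∣
  -p≤∣p∣ p = ≡.subst (ℚ.- p ℚ.≤_) (ℚ.∣-p∣≡∣p∣ p) (p≤∣p∣ (ℚ.- p))

  ∣p-q∣≡∣q-p∣ : ∀ p q → ℚ.∣ p ℚ.- q ∣ ≡ ℚ.∣ q ℚ.- p ∣
  ∣p-q∣≡∣q-p∣ p q = ≡.trans (≡.sym (ℚ.∣-p∣≡∣p∣ (p ℚ.- q)))
    (≡.cong ℚ.∣_∣ (solve 2 (λ p q → :- (p :- q) := q :- p) ≡.refl p q))
    where open ℚ-Solver

  ≤⇒-≤ : ∀ {p q r} → p ℚ.≤ q ℚ.+ r → p ℚ.- q ℚ.≤ r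
  ≤⇒-≤ {p} {q} {r} h = ≡.subst (p ℚ.- q ℚ.≤_)
    (solve 2 (λ q r → (q :+ r) :- q := r) ≡.refl q r) (ℚ.+-monoˡ-≤ (ℚ.- q) h)
    where open ℚ-Solver

  -≤⇒≤ : ∀ {p q r} → p ℚ.- q ℚ.≤ r → p ℚ.≤ q ℚ.+ r
  -≤⇒≤ {p} {q} {r} h = ≡.subst (ℚ._≤ q ℚ.+ r)
    (solve 2 (λ p q → q :+ (p :- q) := p) ≡.refl p q) (ℚ.+-monoʳ-≤ q h)
    where open ℚ-Solver

  ∣p∣-∣q∣≤∣p-q∣ : ∀ p q → ℚ.∣ p ∣ ℚ.- ℚ.∣ q ∣ ℚ.≤ ℚ.∣ p ℚ.- q ∣
  ∣p∣-∣q∣≤∣p-q∣ p q = ≤⇒-≤ (≡.subst (λ r → ℚ.∣ r ∣ ℚ.≤ ℚ.∣ q ∣ ℚ.+ ℚ.∣ p ℚ.- q ∣)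
    (solve 2 (λ p q → q :+ (p :- q) := p) ≡.refl p q)
    (ℚ.∣p+q∣≤∣p∣+∣q∣ q (p ℚ.- q)))
    where open ℚ-Solver

  ∣∣p∣-∣q∣∣≤∣p-q∣ : ∀ p q → ℚ.∣ ℚ.∣ p ∣ ℚ.- ℚ.∣ q ∣ ∣ ℚ.≤ ℚ.∣ p ℚ.- q ∣
  ∣∣p∣-∣q∣∣≤∣p-q∣ p q = ∣∣≤ _ (∣p∣-∣q∣≤∣p-q∣ p q)
    (≡.subst₂ ℚ._≤_
      (solve 2 (λ a b → a :- b := :- (b :- a)) ≡.refl ℚ.∣ q ∣ ℚ.∣ p ∣)
      (∣p-q∣≡∣q-p∣ q p) (∣p∣-∣q∣≤∣p-q∣ q p))
    where open ℚ-Solver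

  ∣p-p∣≤ : ∀ p {ε} → 0ℚ ℚ.< ε → ℚ.∣ p ℚ.- p ∣ ℚ.≤ ε
  ∣p-p∣≤ p {ε} ε>0 = ≡.subst (λ r → ℚ.∣ r ∣ ℚ.≤ ε) (≡.sym (ℚ.+-inverseʳ p)) (ℚ.<⇒≤ ε>0)

-- A real number is a Cauchy sequence of rationals; distinct sequences may
-- represent the same real, so equality of reals is _≃_, not _≡_.

IsCauchy : (ℕ → ℚ) → Set
IsCauchy x = ∀ ε → 0ℚ ℚ.< ε →
  ∃ λ N → ∀ m n → N ℕ.≤ m → N ℕ.≤ n → ℚ.∣ x m ℚ.- x n ∣ ℚ.≤ ε

record ℝ : Set where
  no-eta-equality
  field
    seq    : ℕ → ℚ
    cauchy : IsCauchy seq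

open ℝ public

Eventually : (ℕ → Set) → Set
Eventually P = ∃ λ N → ∀ n → N ℕ.≤ n → P n

infix 4 _≃_ _≤_

data _≃_ (x y : ℝ) : Set where
  *≃* : (∀ ε → 0ℚ ℚ.< ε → Eventually λ n → ℚ.∣ seq x n ℚ.- seq y n ∣ ℚ.≤ ε) → x ≃ y

data _≤_ (x y : ℝ) : Set where
  *≤* : (∀ ε → 0ℚ ℚ.< ε → Eventually λ n → seq x n ℚ.≤ seq y n ℚ.+ ε) → x ≤ y

private
  always : ∀ {P : ℕ → Set} → (∀ n → P n) → Eventually P
  always p = 0 , λ n _ → p n

  both : ∀ {P Q R : ℕ → Set} → (∀ n → P n → Q n → R n) →
         Eventually P → Eventually Q → Eventually R
  both f (M , p) (N , q) = M ℕ.⊔ N , λ n h →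
    f n (p n (ℕ.m⊔n≤o⇒m≤o M N h)) (q n (ℕ.m⊔n≤o⇒n≤o M N h))

  weaken : ∀ {P Q : ℕ → Set} → (∀ n → P n → Q n) → Eventually P → Eventually Q
  weaken f (N , p) = N , λ n h → f n (p n h)

  bounded : ∀ x → ∃ λ B → 0ℚ ℚ.< B × Eventually λ n → ℚ.∣ seq x n ∣ ℚ.≤ B
  bounded x =
    let N , h = cauchy x 1ℚ 1>0
        a = seq x N
    in 1ℚ ℚ.+ ℚ.∣ a ∣
      , ℚ.+-mono-<-≤ 1>0 (ℚ.0≤∣p∣ a)
      , N , λ n N≤n → ≡.subst (λ r → ℚ.∣ r ∣ ℚ.≤ 1ℚ ℚ.+ ℚ.∣ a ∣)
          (solve 2 (λ p q → (p :- q) :+ q := p) ≡.refl (seq x n) a)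
          (∣+∣≤ (seq x n ℚ.- a) a (h n N N≤n ℕ.≤-refl) ℚ.≤-refl)
    where open ℚ-Solver

fromℚ : ℚ → ℝ
fromℚ q .seq    _       = q
fromℚ q .cauchy ε ε>0 = 0 , λ _ _ _ _ → ∣p-p∣≤ q ε>0

0ℝ 1ℝ : ℝ
0ℝ = fromℚ 0ℚ
1ℝ = fromℚ 1ℚ

infixl 6 _+_ _-_
infixl 7 _*_
infix  8 -_

_+_ : ℝ → ℝ → ℝ
(x + y) .seq n = seq x n ℚ.+ seq y n
(x + y) .cauchy ε ε>0 =
  let M , p = cauchy x _ (½-pos ε>0)
      N , q = cauchy y _ (½-pos ε>0)
  in M ℕ.⊔ N , λ m n hm hn → ≡.subst₂ (λ r e → ℚ.∣ r ∣ ℚ.≤ e)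
  (solve 4 (λ a b c d → (a :- b) :+ (c :- d) := (a :+ c) :- (b :+ d)) ≡.refl
     (seq x m) (seq x n) (seq y m) (seq y n))
  (½+½ ε)
  (∣+∣≤ _ _ (p m n (ℕ.m⊔n≤o⇒m≤o M N hm) (ℕ.m⊔n≤o⇒m≤o M N hn))
            (q m n (ℕ.m⊔n≤o⇒n≤o M N hm) (ℕ.m⊔n≤o⇒n≤o M N hn)))
  where open ℚ-Solver

-_ : ℝ → ℝ
(- x) .seq n = ℚ.- seq x n
(- x) .cauchy ε ε>0 = let N , p = cauchy x ε ε>0 in N , λ m n hm hn → ≡.subst (λ r → r ℚ.≤ ε)
  (≡.trans (∣p-q∣≡∣q-p∣ (seq x m) (seq x n))
    (≡.cong ℚ.∣_∣ (solve 2 (λ a b → a :- b := (:- b) :- (:- a)) ≡.refl (seq x n) (seq x m))))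
  (p m n hm hn)
  where open ℚ-Solver

_-_ : ℝ → ℝ → ℝ
x - y = x + (- y)

∣_∣ : ℝ → ℝ
∣ x ∣ .seq n = ℚ.∣ seq x n ∣
∣ x ∣ .cauchy ε ε>0 = let N , p = cauchy x ε ε>0 in N , λ m n hm hn →
  ℚ.≤-trans (∣∣p∣-∣q∣∣≤∣p-q∣ (seq x m) (seq x n)) (p m n hm hn)

_*_ : ℝ → ℝ → ℝ
(x * y) .seq n = seq x n ℚ.* seq y n
(x * y) .cauchy ε ε>0 =
  let A , A>0 , K , a = bounded x
      B , B>0 , L , b = bounded y
      δ , δ>0 , Aδ = divide (½-pos ε>0) A>0
      η , η>0 , Bη = divide (½-pos ε>0) B>0
      M , p = cauchy y δ δ>0
      N , q = cauchy x η η>0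
      l : ∀ {k} → (K ℕ.⊔ L) ℕ.⊔ (M ℕ.⊔ N) ℕ.≤ k → K ℕ.⊔ L ℕ.≤ k
      l = ℕ.m⊔n≤o⇒m≤o (K ℕ.⊔ L) (M ℕ.⊔ N)
      r : ∀ {k} → (K ℕ.⊔ L) ℕ.⊔ (M ℕ.⊔ N) ℕ.≤ k → M ℕ.⊔ N ℕ.≤ k
      r = ℕ.m⊔n≤o⇒n≤o (K ℕ.⊔ L) (M ℕ.⊔ N)
  in (K ℕ.⊔ L) ℕ.⊔ (M ℕ.⊔ N) , λ m n hm hn → ≡.subst₂ (λ r e → ℚ.∣ r ∣ ℚ.≤ e)
    (solve 4 (λ a b c d → a :* (c :- d) :+ d :* (a :- b) := a :* c :- b :* d) ≡.refl
       (seq x m) (seq x n) (seq y m) (seq y n))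
    (≡.trans (≡.cong₂ ℚ._+_ Aδ Bη) (½+½ ε))
    (∣+∣≤ (seq x m ℚ.* (seq y m ℚ.- seq y n)) (seq y n ℚ.* (seq x m ℚ.- seq x n))
      (∣*∣≤ (seq x m) (seq y m ℚ.- seq y n)
        (a m (ℕ.m⊔n≤o⇒m≤o K L (l hm)))
        (p m n (ℕ.m⊔n≤o⇒m≤o M N (r hm)) (ℕ.m⊔n≤o⇒m≤o M N (r hn))))
      (∣*∣≤ (seq y n) (seq x m ℚ.- seq x n)
        (b n (ℕ.m⊔n≤o⇒n≤o K L (l hn)))
        (q m n (ℕ.m⊔n≤o⇒n≤o M N (r hm)) (ℕ.m⊔n≤o⇒n≤o M N (r hn)))))
  where open ℚ-Solver

≡⇒≃ : ∀ {x y} → (∀ n → seq x n ≡ seq y n) → x ≃ y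
≡⇒≃ {x} {y} e = *≃* λ ε ε>0 → always λ n →
  ≡.subst (λ r → ℚ.∣ seq x n ℚ.- r ∣ ℚ.≤ ε) (e n) (∣p-p∣≤ (seq x n) ε>0)

≃-refl : ∀ {x} → x ≃ x
≃-refl = ≡⇒≃ λ _ → ≡.refl

≃-sym : ∀ {x y} → x ≃ y → y ≃ x
≃-sym {x} {y} (*≃* h) = *≃* λ ε ε>0 →
  weaken (λ n → ≡.subst (ℚ._≤ ε) (∣p-q∣≡∣q-p∣ (seq x n) (seq y n))) (h ε ε>0)

≃-trans : ∀ {x y z} → x ≃ y → y ≃ z → x ≃ z
≃-trans {x} {y} {z} (*≃* h) (*≃* k) = *≃* λ ε ε>0 →
  both (λ n p q → ≡.subst₂ (λ r e → ℚ.∣ r ∣ ℚ.≤ e)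
      (solve 3 (λ a b c → (a :- b) :+ (b :- c) := a :- c) ≡.refl (seq x n) (seq y n) (seq z n))
      (½+½ ε) (∣+∣≤ _ _ p q))
    (h _ (½-pos ε>0)) (k _ (½-pos ε>0))
  where open ℚ-Solver

+-cong : ∀ {x x′ y y′} → x ≃ x′ → y ≃ y′ → x + y ≃ x′ + y′
+-cong {x} {x′} {y} {y′} (*≃* h) (*≃* k) = *≃* λ ε ε>0 →
  both (λ n p q → ≡.subst₂ (λ r e → ℚ.∣ r ∣ ℚ.≤ e)
      (solve 4 (λ a b c d → (a :- b) :+ (c :- d) := (a :+ c) :- (b :+ d)) ≡.refl
         (seq x n) (seq x′ n) (seq y n) (seq y′ n))
      (½+½ ε) (∣+∣≤ _ _ p q))
    (h _ (½-pos ε>0)) (k _ (½-pos ε>0))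
  where open ℚ-Solver

-‿cong : ∀ {x y} → x ≃ y → - x ≃ - y
-‿cong {x} {y} (*≃* h) = *≃* λ ε ε>0 →
  weaken (λ n → ≡.subst (ℚ._≤ ε)
      (≡.trans (∣p-q∣≡∣q-p∣ (seq x n) (seq y n))
        (≡.cong ℚ.∣_∣ (solve 2 (λ a b → a :- b := (:- b) :- (:- a)) ≡.refl (seq y n) (seq x n)))))
    (h ε ε>0)
  where open ℚ-Solver

∣∣-cong : ∀ {x y} → x ≃ y → ∣ x ∣ ≃ ∣ y ∣
∣∣-cong {x} {y} (*≃* h) = *≃* λ ε ε>0 →
  weaken (λ n → ℚ.≤-trans (∣∣p∣-∣q∣∣≤∣p-q∣ (seq x n) (seq y n))) (h ε ε>0)

private
  *-congˡ : ∀ {x y z} → y ≃ z → x * y ≃ x * z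
  *-congˡ {x} {y} {z} (*≃* h) = *≃* λ ε ε>0 →
    let A , A>0 , a = bounded x
        δ , δ>0 , Aδ = divide ε>0 A>0
    in
    both (λ n p q → ≡.subst₂ (λ r e → ℚ.∣ r ∣ ℚ.≤ e)
        (solve 3 (λ a b c → a :* (b :- c) := a :* b :- a :* c) ≡.refl
           (seq x n) (seq y n) (seq z n))
        Aδ (∣*∣≤ (seq x n) (seq y n ℚ.- seq z n) p q))
      a (h δ δ>0)
    where open ℚ-Solver

  *-comm : ∀ x y → x * y ≃ y * x
  *-comm x y = ≡⇒≃ λ n → ℚ.*-comm (seq x n) (seq y n)

*-cong : ∀ {x x′ y y′} → x ≃ x′ → y ≃ y′ → x * y ≃ x′ * y′
*-cong {x} {x′} {y} {y′} h k =
  ≃-trans (*-congˡ {x} k) (≃-trans (*-comm x y′) (≃-trans (*-congˡ {y′} h) (*-comm y′ x′)))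

ℝ-commutativeRing : CommutativeRing 0ℓ 0ℓ
ℝ-commutativeRing = record
  { Carrier = ℝ ; _≈_ = _≃_ ; _+_ = _+_ ; _*_ = _*_ ; -_ = -_ ; 0# = 0ℝ ; 1# = 1ℝ
  ; isCommutativeRing = record
    { isRing = record
      { +-isAbelianGroup = record
        { isGroup = record
          { isMonoid = record
            { isSemigroup = record
              { isMagma = record
                { isEquivalence = record { refl = ≃-refl ; sym = ≃-sym ; trans = ≃-trans }
                ; ∙-cong = +-cong }
              ; assoc = λ x y z → ≡⇒≃ λ n → ℚ.+-assoc (seq x n) (seq y n) (seq z n) }
            ; identity = (λ x → ≡⇒≃ λ n → ℚ.+-identityˡ (seq x n))
                       , (λ x → ≡⇒≃ λ n → ℚ.+-identityʳ (seq x n)) }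
          ; inverse = (λ x → ≡⇒≃ λ n → ℚ.+-inverseˡ (seq x n))
                    , (λ x → ≡⇒≃ λ n → ℚ.+-inverseʳ (seq x n))
          ; ⁻¹-cong = -‿cong }
        ; comm = λ x y → ≡⇒≃ λ n → ℚ.+-comm (seq x n) (seq y n) }
      ; *-cong = *-cong
      ; *-assoc = λ x y z → ≡⇒≃ λ n → ℚ.*-assoc (seq x n) (seq y n) (seq z n)
      ; *-identity = (λ x → ≡⇒≃ λ n → ℚ.*-identityˡ (seq x n))
                   , (λ x → ≡⇒≃ λ n → ℚ.*-identityʳ (seq x n))
      ; distrib = (λ x y z → ≡⇒≃ λ n → ℚ.*-distribˡ-+ (seq x n) (seq y n) (seq z n))
                , (λ x y z → ≡⇒≃ λ n → ℚ.*-distribʳ-+ (seq x n) (seq y n) (seq z n)) }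
    ; *-comm = *-comm } }

open import Algebra.Properties.CommutativeMonoid.Sum
  (CommutativeRing.+-commutativeMonoid ℝ-commutativeRing) public using (sum)
open import Algebra.Properties.Semiring.Exp
  (CommutativeRing.semiring ℝ-commutativeRing) public using (_^_)

private
  ℝ-almost = ACR.fromCommutativeRing ℝ-commutativeRing

  ℚ⟶ℝ : CommutativeRing.rawRing ℚ.+-*-commutativeRing ACR.-Raw-AlmostCommutative⟶ ℝ-almost
  ℚ⟶ℝ = record
    { ⟦_⟧    = fromℚ
    ; +-homo = λ _ _ → ≡⇒≃ λ _ → ≡.refl
    ; *-homo = λ _ _ → ≡⇒≃ λ _ → ≡.refl
    ; -‿homo = λ _ → ≡⇒≃ λ _ → ≡.refl
    ; 0-homo = ≃-refl
    ; 1-homo = ≃-refl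
    }

  _coeff≟_ : ∀ p q → Maybe (fromℚ p ≃ fromℚ q)
  p coeff≟ q with p ℚ.≟ q
  ... | yes p≡q = just (≡⇒≃ λ _ → p≡q)
  ... | no  _   = nothing

module ℝ-Solver = RingSolver (CommutativeRing.rawRing ℚ.+-*-commutativeRing) ℝ-almost ℚ⟶ℝ _coeff≟_

≤-reflexive : ∀ {x y} → x ≃ y → x ≤ y
≤-reflexive {x} {y} (*≃* h) = *≤* λ ε ε>0 →
  weaken (λ n p → -≤⇒≤ (ℚ.≤-trans (p≤∣p∣ (seq x n ℚ.- seq y n)) p)) (h ε ε>0)

≤-refl : ∀ {x} → x ≤ x
≤-refl = ≤-reflexive ≃-refl

≤-trans : ∀ {x y z} → x ≤ y → y ≤ z → x ≤ z
≤-trans {x} {y} {z} (*≤* h) (*≤* k) = *≤* λ ε ε>0 →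
  both (λ n p q → ℚ.≤-trans p (≡.subst (seq y n ℚ.+ ½ ℚ.* ε ℚ.≤_)
      (≡.trans (ℚ.+-assoc (seq z n) (½ ℚ.* ε) (½ ℚ.* ε)) (≡.cong (seq z n ℚ.+_) (½+½ ε)))
      (ℚ.+-monoˡ-≤ (½ ℚ.* ε) q)))
    (h _ (½-pos ε>0)) (k _ (½-pos ε>0))

≤-resp : ∀ {x x′ y y′} → x ≃ x′ → y ≃ y′ → x ≤ y → x′ ≤ y′
≤-resp e f h = ≤-trans (≤-reflexive (≃-sym e)) (≤-trans h (≤-reflexive f))

+-mono-≤ : ∀ {x x′ y y′} → x ≤ x′ → y ≤ y′ → x + y ≤ x′ + y′
+-mono-≤ {x} {x′} {y} {y′} (*≤* h) (*≤* k) = *≤* λ ε ε>0 →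
  both (λ n p q → ≡.subst (seq x n ℚ.+ seq y n ℚ.≤_)
      (≡.trans
        (solve 3 (λ a b e → (a :+ e) :+ (b :+ e) := (a :+ b) :+ (e :+ e)) ≡.refl
          (seq x′ n) (seq y′ n) (½ ℚ.* ε))
        (≡.cong ((seq x′ n ℚ.+ seq y′ n) ℚ.+_) (½+½ ε)))
      (ℚ.+-mono-≤ p q))
    (h _ (½-pos ε>0)) (k _ (½-pos ε>0))
  where open ℚ-Solver

x≤y⇒0≤y-x : ∀ {x y} → x ≤ y → 0ℝ ≤ y - x
x≤y⇒0≤y-x {x} {y} h = ≤-resp (solve 1 (λ x → x :- x := con 0ℚ) ≃-refl x) ≃-refl (+-mono-≤ h (≤-refl { - x}))
  where open ℝ-Solver

0≤y-x⇒x≤y : ∀ {x y} → 0ℝ ≤ y - x → x ≤ y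
0≤y-x⇒x≤y {x} {y} h = ≤-resp (solve 1 (λ x → con 0ℚ :+ x := x) ≃-refl x)
  (solve 2 (λ x y → (y :- x) :+ x := y) ≃-refl x y) (+-mono-≤ h (≤-refl {x}))
  where open ℝ-Solver

0≤x*y : ∀ {x y} → 0ℝ ≤ x → 0ℝ ≤ y → 0ℝ ≤ x * y
0≤x*y {x} {y} (*≤* h) (*≤* k) = *≤* λ ε ε>0 →
  let A , A>0 , a = bounded x
      B , B>0 , b = bounded y
      δ , δ>0 , Aδ = divide ε>0 A>0
      η , η>0 , Bη = divide ε>0 B>0
  in both (λ n p q → lemma (seq x n) (seq y n) (ℚ.<⇒≤ δ>0) Aδ Bη (proj₁ p) (proj₁ q) (proj₂ p) (proj₂ q))
       (both (λ _ → _,_) (h η η>0) a) (both (λ _ → _,_) (k δ δ>0) b)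
  where
  lemma : ∀ p q {A B δ η ε} → 0ℚ ℚ.≤ δ → A ℚ.* δ ≡ ε → B ℚ.* η ≡ ε →
    0ℚ ℚ.≤ p ℚ.+ η → 0ℚ ℚ.≤ q ℚ.+ δ → ℚ.∣ p ∣ ℚ.≤ A → ℚ.∣ q ∣ ℚ.≤ B → 0ℚ ℚ.≤ p ℚ.* q ℚ.+ ε
  lemma p q {A} {B} {δ} {η} {ε} 0≤δ Aδ Bη p≥ q≥ p≤A q≤B with ℚ.≤-total 0ℚ p
  ... | inj₁ 0≤p = ℚ.≤-trans
      (≡.subst₂ ℚ._≤_ (ℚ.*-zeroʳ p) (ℚ.*-distribˡ-+ p q δ)
        (ℚ.*-monoˡ-≤-nonNeg p {{ℚ.nonNegative 0≤p}} q≥))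
      (ℚ.+-monoʳ-≤ (p ℚ.* q) (≡.subst (p ℚ.* δ ℚ.≤_) Aδ
        (ℚ.*-monoʳ-≤-nonNeg δ {{ℚ.nonNegative 0≤δ}} (ℚ.≤-trans (p≤∣p∣ p) p≤A))))
  ... | inj₂ p≤0 = ≡.subst (ℚ._≤ p ℚ.* q ℚ.+ ε) (ℚ.+-inverseʳ (p ℚ.* q))
      (ℚ.+-monoʳ-≤ (p ℚ.* q) (ℚ.≤-trans (-p≤∣p∣ (p ℚ.* q))
        (≡.subst₂ ℚ._≤_ (≡.cong ℚ.∣_∣ (ℚ.*-comm q p)) Bη
          (∣*∣≤ q p q≤B (∣∣≤ p (ℚ.≤-trans p≤0 (ℚ.≤-trans (ℚ.neg-antimono-≤ p≤0) -p≤η)) -p≤η)))))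
    where
    -p≤η : ℚ.- p ℚ.≤ η
    -p≤η = ≡.subst (ℚ._≤ η) (ℚ.+-identityˡ (ℚ.- p)) (≤⇒-≤ {0ℚ} {p} {η} p≥)

*-monoˡ-≤ : ∀ {x y z} → 0ℝ ≤ x → y ≤ z → x * y ≤ x * z
*-monoˡ-≤ {x} {y} {z} 0≤x y≤z = 0≤y-x⇒x≤y (≤-resp ≃-refl
  (solve 3 (λ x y z → x :* (z :- y) := x :* z :- x :* y) ≃-refl x y z)
  (0≤x*y 0≤x (x≤y⇒0≤y-x y≤z)))
  where open ℝ-Solver

0≤∣x∣ : ∀ x → 0ℝ ≤ ∣ x ∣
0≤∣x∣ x = *≤* λ ε ε>0 → always λ n →
  ℚ.+-mono-≤ (ℚ.0≤∣p∣ (seq x n)) (ℚ.<⇒≤ ε>0)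

x≤∣x∣ : ∀ x → x ≤ ∣ x ∣
x≤∣x∣ x = *≤* λ ε ε>0 → always λ n → ≡.subst (ℚ._≤ ℚ.∣ seq x n ∣ ℚ.+ ε) (ℚ.+-identityʳ _)
  (ℚ.+-mono-≤ (p≤∣p∣ (seq x n)) (ℚ.<⇒≤ ε>0))

∣-x∣≃∣x∣ : ∀ x → ∣ - x ∣ ≃ ∣ x ∣
∣-x∣≃∣x∣ x = ≡⇒≃ λ n → ℚ.∣-p∣≡∣p∣ (seq x n)

-x≤∣x∣ : ∀ x → - x ≤ ∣ x ∣
-x≤∣x∣ x = ≤-resp ≃-refl (∣-x∣≃∣x∣ x) (x≤∣x∣ (- x))

∣x∣≤ : ∀ {x a} → x ≤ a → - x ≤ a → ∣ x ∣ ≤ a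
∣x∣≤ {x} (*≤* h) (*≤* k) = *≤* λ ε ε>0 → both (λ n → ∣∣≤ (seq x n)) (h ε ε>0) (k ε ε>0)

∣x+y∣≤ : ∀ {x y a b} → ∣ x ∣ ≤ a → ∣ y ∣ ≤ b → ∣ x + y ∣ ≤ a + b
∣x+y∣≤ {x} {y} h k = ∣x∣≤
  (+-mono-≤ (≤-trans (x≤∣x∣ x) h) (≤-trans (x≤∣x∣ y) k))
  (≤-resp (solve 2 (λ x y → (:- x) :+ (:- y) := :- (x :+ y)) ≃-refl x y) ≃-refl
    (+-mono-≤ (≤-trans (-x≤∣x∣ x) h) (≤-trans (-x≤∣x∣ y) k)))
  where open ℝ-Solver

∣x*y∣≤ : ∀ {x y a b} → ∣ x ∣ ≤ a → ∣ y ∣ ≤ b → ∣ x * y ∣ ≤ a * b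
∣x*y∣≤ {x} {y} {a} {b} h k = ≤-trans
  (≤-resp (≡⇒≃ λ n → ≡.sym (ℚ.∣p*q∣≡∣p∣*∣q∣ (seq x n) (seq y n))) ≃-refl
    (*-monoˡ-≤ (0≤∣x∣ x) k))
  (≤-resp (*-comm b ∣ x ∣) (*-comm b a) (*-monoˡ-≤ (≤-trans (0≤∣x∣ y) k) h))

∣∣≤-resp : ∀ {x y a b} → x ≃ y → a ≃ b → ∣ x ∣ ≤ a → ∣ y ∣ ≤ b
∣∣≤-resp e f = ≤-resp (∣∣-cong e) f

∣x∣≤0⇒x≃0 : ∀ {x} → ∣ x ∣ ≤ 0ℝ → x ≃ 0ℝ
∣x∣≤0⇒x≃0 {x} (*≤* h) = *≃* λ ε ε>0 → weaken
  (λ n → ≡.subst₂ ℚ._≤_ (≡.cong ℚ.∣_∣ (≡.sym (ℚ.+-identityʳ (seq x n)))) (ℚ.+-identityˡ ε)) (h ε ε>0)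

x-y≃0⇒x≃y : ∀ {x y} → x - y ≃ 0ℝ → x ≃ y
x-y≃0⇒x≃y {x} {y} e = ≃-trans (solve 2 (λ x y → x := (x :- y) :+ y) ≃-refl x y)
  (≃-trans (+-cong e (≃-refl {y})) (solve 1 (λ y → con 0ℚ :+ y := y) ≃-refl y))
  where open ℝ-Solver

fromℚ-mono-≤ : ∀ {p q} → p ℚ.≤ q → fromℚ p ≤ fromℚ q
fromℚ-mono-≤ {p} {q} p≤q = *≤* λ ε ε>0 → always λ n →
  ≡.subst (ℚ._≤ q ℚ.+ ε) (ℚ.+-identityʳ p) (ℚ.+-mono-≤ p≤q (ℚ.<⇒≤ ε>0))

archimedean : ∀ x → ∃ λ B → 0ℚ ℚ.< B × ∣ x ∣ ≤ fromℚ B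
archimedean x = let B , B>0 , b = bounded x in
  B , B>0 , *≤* λ ε ε>0 → weaken (λ n p → ≡.subst (ℚ._≤ B ℚ.+ ε) (ℚ.+-identityʳ _)
    (ℚ.+-mono-≤ p (ℚ.<⇒≤ ε>0))) b

-- Only meaningful for a ≤ b: otherwise there is no tagged partition and
-- every number satisfies IsIntegral f a b.

record TaggedPartition (a b : ℝ) : Set where
  field
    size      : ℕ
    point     : Fin (suc size) → ℝ
    tag       : Fin size → ℝ
    start     : point zero ≃ a
    end       : point (Fin.fromℕ size) ≃ b
    tag-lower : ∀ i → point (inject₁ i) ≤ tag i
    tag-upper : ∀ i → tag i ≤ point (suc i)

  width : Fin size → ℝ
  width i = point (suc i) - point (inject₁ i)

  mesh≤ : ℝ → Set
  mesh≤ δ = ∀ i → width i ≤ δ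

  riemannSum : (ℝ → ℝ) → ℝ
  riemannSum f = sum λ i → f (tag i) * width i

IsIntegral : (ℝ → ℝ) → ℝ → ℝ → ℝ → Set
IsIntegral f a b I = ∀ ε → 0ℚ ℚ.< ε → ∃ λ δ → 0ℚ ℚ.< δ ×
  ((P : TaggedPartition a b) → let open TaggedPartition P in
    mesh≤ (fromℚ δ) → ∣ riemannSum f - I ∣ ≤ fromℚ ε)

Integrable : (ℝ → ℝ) → ℝ → ℝ → Set
Integrable f a b = ∃ (IsIntegral f a b)

∫ : (f : ℝ → ℝ) (a b : ℝ) → Integrable f a b → ℝ
∫ f a b = proj₁

record Unit (t : ℝ) : Set where
  constructor _,_
  field
    0≤t : 0ℝ ≤ t
    t≤1 : t ≤ 1ℝ

  ∣t∣≤1 : ∣ t ∣ ≤ 1ℝ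
  ∣t∣≤1 = ∣x∣≤ t≤1 (0≤y-x⇒x≤y (≤-resp (solve 0 (con 0ℚ :+ con 0ℚ := con 0ℚ) ≃-refl)
    (solve 1 (λ t → t :+ con 1ℚ := con 1ℚ :- (:- t)) ≃-refl t)
    (+-mono-≤ 0≤t (fromℚ-mono-≤ (ℚ.<⇒≤ 1>0)))))
    where open ℝ-Solver

-- F′ = f on [0, 1], with the error of the linear approximation bounded
-- uniformly; together with the other bounds this passes to products.
record Antiderivative (F f : ℝ → ℝ) : Set where
  field
    C K B M    : ℝ
    F-bounded  : ∀ {t} → Unit t → ∣ F t ∣ ≤ C
    F-lipschitz : ∀ {u v} → Unit u → Unit v → ∣ F u - F v ∣ ≤ K * ∣ u - v ∣
    f-bounded  : ∀ {t} → Unit t → ∣ f t ∣ ≤ B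
    derivative : ∀ {u t v δ} → Unit u → Unit t → Unit v → ∣ u - t ∣ ≤ δ → ∣ v - t ∣ ≤ δ →
                 ∣ (F v - F u) - f t * (v - u) ∣ ≤ (M * δ) * ∣ v - u ∣
    0≤K : 0ℝ ≤ K
    0≤M : 0ℝ ≤ M

module _ where
  open ℝ-Solver
  open Antiderivative

  private
    ∣0∣≤ : ∀ {x a} → x ≃ 0ℝ → 0ℝ ≤ a → ∣ x ∣ ≤ a
    ∣0∣≤ {x} e h = ∣x∣≤ (≤-trans (≤-reflexive e) h)
      (≤-trans (≤-reflexive (≃-trans (-‿cong e) (≡⇒≃ λ _ → ≡.refl))) h)

    0≤0 : 0ℝ ≤ 0ℝ
    0≤0 = ≤-refl

    0≤+ : ∀ {x y} → 0ℝ ≤ x → 0ℝ ≤ y → 0ℝ ≤ x + y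
    0≤+ h k = ≤-resp (solve 0 (con 0ℚ :+ con 0ℚ := con 0ℚ) ≃-refl) ≃-refl (+-mono-≤ h k)

  resp : ∀ {F G f g} → (∀ t → F t ≃ G t) → (∀ t → f t ≃ g t) → Antiderivative F f → Antiderivative G g
  resp e e′ D = record
    { C = C D ; K = K D ; B = B D ; M = M D
    ; F-bounded = λ i → ∣∣≤-resp (e _) ≃-refl (F-bounded D i)
    ; F-lipschitz = λ i j → ∣∣≤-resp (+-cong (e _) (-‿cong (e _))) ≃-refl (F-lipschitz D i j)
    ; f-bounded = λ i → ∣∣≤-resp (e′ _) ≃-refl (f-bounded D i)
    ; derivative = λ i j k h₁ h₂ → ∣∣≤-resp
        (+-cong (+-cong (e _) (-‿cong (e _))) (-‿cong (*-cong (e′ _) ≃-refl))) ≃-refl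
        (derivative D i j k h₁ h₂)
    ; 0≤K = 0≤K D ; 0≤M = 0≤M D }

  constant : ∀ c → Antiderivative (λ _ → c) (λ _ → 0ℝ)
  constant c = record
    { C = ∣ c ∣ ; K = 0ℝ ; B = 0ℝ ; M = 0ℝ
    ; F-bounded = λ _ → ≤-refl
    ; F-lipschitz = λ {u} {v} _ _ → ∣0∣≤ (solve 1 (λ c → c :- c := con 0ℚ) ≃-refl c)
        (≤-reflexive (solve 1 (λ a → con 0ℚ := con 0ℚ :* a) ≃-refl ∣ u - v ∣))
    ; f-bounded = λ _ → ∣0∣≤ ≃-refl 0≤0
    ; derivative = λ {u} {t} {v} {δ} _ _ _ _ _ → ∣0∣≤
        (solve 2 (λ c w → (c :- c) :- con 0ℚ :* w := con 0ℚ) ≃-refl c (v - u))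
        (≤-reflexive (solve 2 (λ δ a → con 0ℚ := (con 0ℚ :* δ) :* a) ≃-refl δ ∣ v - u ∣))
    ; 0≤K = 0≤0 ; 0≤M = 0≤0 }

  scale : ∀ {F f} c → Antiderivative F f → Antiderivative (λ t → c * F t) (λ t → c * f t)
  scale {F} {f} c D = record
    { C = ∣ c ∣ * C D ; K = ∣ c ∣ * K D ; B = ∣ c ∣ * B D ; M = ∣ c ∣ * M D
    ; F-bounded = λ i → ∣x*y∣≤ (≤-refl {∣ c ∣}) (F-bounded D i)
    ; F-lipschitz = λ {u} {v} i j → ∣∣≤-resp
        (solve 3 (λ c x y → c :* (x :- y) := c :* x :- c :* y) ≃-refl c (F u) (F v))
        (solve 3 (λ c k a → c :* (k :* a) := (c :* k) :* a) ≃-refl (∣ c ∣) (K D) (∣ u - v ∣))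
        (∣x*y∣≤ (≤-refl {∣ c ∣}) (F-lipschitz D i j))
    ; f-bounded = λ i → ∣x*y∣≤ (≤-refl {∣ c ∣}) (f-bounded D i)
    ; derivative = λ {u} {t} {v} {δ} i j k h₁ h₂ → ∣∣≤-resp
        (solve 5 (λ c x y z w → c :* ((x :- y) :- z :* w) := (c :* x :- c :* y) :- (c :* z) :* w)
          ≃-refl c (F v) (F u) (f t) (v - u))
        (solve 4 (λ c m d a → c :* ((m :* d) :* a) := ((c :* m) :* d) :* a)
          ≃-refl (∣ c ∣) (M D) δ (∣ v - u ∣))
        (∣x*y∣≤ (≤-refl {∣ c ∣}) (derivative D i j k h₁ h₂))
    ; 0≤K = 0≤x*y (0≤∣x∣ c) (0≤K D) ; 0≤M = 0≤x*y (0≤∣x∣ c) (0≤M D) }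

  add : ∀ {F G f g} → Antiderivative F f → Antiderivative G g →
        Antiderivative (λ t → F t + G t) (λ t → f t + g t)
  add {F} {G} {f} {g} D E = record
    { C = C D + C E ; K = K D + K E ; B = B D + B E ; M = M D + M E
    ; F-bounded = λ i → ∣x+y∣≤ (F-bounded D i) (F-bounded E i)
    ; F-lipschitz = λ {u} {v} i j → ∣∣≤-resp
        (solve 4 (λ a b c d → (a :- b) :+ (c :- d) := (a :+ c) :- (b :+ d)) ≃-refl (F u) (F v) (G u) (G v))
        (solve 3 (λ k l a → k :* a :+ l :* a := (k :+ l) :* a) ≃-refl (K D) (K E) ∣ u - v ∣)
        (∣x+y∣≤ (F-lipschitz D i j) (F-lipschitz E i j))
    ; f-bounded = λ i → ∣x+y∣≤ (f-bounded D i) (f-bounded E i)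
    ; derivative = λ {u} {t} {v} {δ} i j k h₁ h₂ → ∣∣≤-resp
        (solve 7 (λ a b c d p q w → ((a :- b) :- p :* w) :+ ((c :- d) :- q :* w)
                   := ((a :+ c) :- (b :+ d)) :- (p :+ q) :* w)
          ≃-refl (F v) (F u) (G v) (G u) (f t) (g t) (v - u))
        (solve 4 (λ m n d a → (m :* d) :* a :+ (n :* d) :* a := ((m :+ n) :* d) :* a)
          ≃-refl (M D) (M E) δ ∣ v - u ∣)
        (∣x+y∣≤ (derivative D i j k h₁ h₂) (derivative E i j k h₁ h₂))
    ; 0≤K = 0≤+ (0≤K D) (0≤K E) ; 0≤M = 0≤+ (0≤M D) (0≤M E) }

  times-t : ∀ {F f} → Antiderivative F f →
            Antiderivative (λ t → t * F t) (λ t → F t + t * f t)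
  times-t {F} {f} D = record
    { C = C D ; K = K D + C D ; B = C D + B D ; M = (M D + K D) + B D
    ; F-bounded = λ i → ∣∣≤-resp ≃-refl (1*x (C D)) (∣x*y∣≤ (∣t∣≤1 i) (F-bounded D i))
    ; F-lipschitz = λ {u} {v} i j → ∣∣≤-resp
        (solve 4 (λ u v x y → u :* (x :- y) :+ (u :- v) :* y := u :* x :- v :* y) ≃-refl u v (F u) (F v))
        (solve 3 (λ k c a → con 1ℚ :* (k :* a) :+ a :* c := (k :+ c) :* a) ≃-refl (K D) (C D) ∣ u - v ∣)
        (∣x+y∣≤ (∣x*y∣≤ (∣t∣≤1 i) (F-lipschitz D i j)) (∣x*y∣≤ (≤-refl {∣ u - v ∣}) (F-bounded D j)))
    ; f-bounded = λ i → ∣x+y∣≤ (F-bounded D i)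
        (∣∣≤-resp ≃-refl (1*x (B D)) (∣x*y∣≤ (∣t∣≤1 i) (f-bounded D i)))
    ; derivative = λ {u} {t} {v} {δ} i j k h₁ h₂ → ∣∣≤-resp
        (solve 7 (λ u t v x y z p →
            (v :* ((z :- x) :- p :* (v :- u)) :+ (v :- u) :* (x :- y)) :+ ((v :- t) :* p) :* (v :- u)
            := (v :* z :- u :* x) :- (y :+ t :* p) :* (v :- u))
          ≃-refl u t v (F u) (F t) (F v) (f t))
        (solve 5 (λ m k b d a →
            (con 1ℚ :* ((m :* d) :* a) :+ a :* (k :* d)) :+ (d :* b) :* a
            := (((m :+ k) :+ b) :* d) :* a)
          ≃-refl (M D) (K D) (B D) δ ∣ v - u ∣)
        (∣x+y∣≤
          (∣x+y∣≤
            (∣x*y∣≤ (∣t∣≤1 k) (derivative D i j k h₁ h₂))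
            (∣x*y∣≤ (≤-refl {∣ v - u ∣}) (≤-trans (F-lipschitz D i j) (*-monoˡ-≤ (0≤K D) h₁))))
          (∣x*y∣≤ (∣x*y∣≤ h₂ (f-bounded D j)) (≤-refl {∣ v - u ∣})))
    ; 0≤K = 0≤+ (0≤K D) 0≤C
    ; 0≤M = 0≤+ (0≤+ (0≤M D) (0≤K D)) (≤-trans (0≤∣x∣ _) (f-bounded D unit₀)) }
    where
    open Unit
    1*x : ∀ x → 1ℝ * x ≃ x
    1*x x = solve 1 (λ x → con 1ℚ :* x := x) ≃-refl x
    unit₀ : Unit 0ℝ
    unit₀ = 0≤0 , fromℚ-mono-≤ (ℚ.<⇒≤ 1>0)
    0≤C : 0ℝ ≤ C D
    0≤C = ≤-trans (0≤∣x∣ _) (F-bounded D unit₀)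

  private
    chain : ∀ n (p : Fin (suc n) → ℝ) → (∀ i → p (inject₁ i) ≤ p (suc i)) →
            ∀ i → p zero ≤ p i × p i ≤ p (Fin.fromℕ n)
    chain zero    p mono zero    = ≤-refl , ≤-refl
    chain (suc n) p mono zero    = ≤-refl ,
      ≤-trans (mono zero) (proj₂ (chain n (λ i → p (suc i)) (λ i → mono (suc i)) zero))
    chain (suc n) p mono (suc i) =
      let l , r = chain n (λ i → p (suc i)) (λ i → mono (suc i)) i in
      ≤-trans (mono zero) l , r

    telescope : ∀ {F f} (D : Antiderivative F f) {δ} n
      (p : Fin (suc n) → ℝ) (t : Fin n → ℝ) →
      (∀ i → Unit (p i)) →
      (∀ i → p (inject₁ i) ≤ t i) → (∀ i → t i ≤ p (suc i)) →
      (∀ i → p (suc i) - p (inject₁ i) ≤ δ) →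
      ∣ (F (p (Fin.fromℕ n)) - F (p zero)) - sum (λ i → f (t i) * (p (suc i) - p (inject₁ i))) ∣
        ≤ (M D * δ) * (p (Fin.fromℕ n) - p zero)
    telescope {F} D {δ} zero p t unit lo hi mesh =
      ∣0∣≤ (solve 1 (λ a → (a :- a) :- con 0ℚ := con 0ℚ) ≃-refl (F (p zero)))
        (≤-reflexive (solve 2 (λ m a → con 0ℚ := m :* (a :- a)) ≃-refl (M D * δ) (p zero)))
    telescope {F} {f} D {δ} (suc n) p t unit lo hi mesh = ∣∣≤-resp
      (solve 5 (λ x y z s r → ((y :- x) :- s) :+ ((z :- y) :- r) := (z :- x) :- (s :+ r))
        ≃-refl (F u) (F v) (F w) (f s * (v - u))
        (sum (λ i → f (t (suc i)) * (p (suc (suc i)) - p (suc (inject₁ i))))))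
      (solve 4 (λ m x y z → m :* (y :- x) :+ m :* (z :- y) := m :* (z :- x))
        ≃-refl (M D * δ) u v w)
      (∣x+y∣≤
        (≤-trans (derivative D (unit zero) unit-s (unit (suc zero)) u-s v-s)
          (*-monoˡ-≤ (0≤x*y (0≤M D) 0≤δ) (∣x∣≤ ≤-refl -[v-u]≤)))
        (telescope D n (λ i → p (suc i)) (λ i → t (suc i)) (λ i → unit (suc i))
          (λ i → lo (suc i)) (λ i → hi (suc i)) (λ i → mesh (suc i))))
      where
      u = p zero
      v = p (suc zero)
      w = p (suc (Fin.fromℕ n))
      s = t zero
      u≤v = ≤-trans (lo zero) (hi zero)
      0≤v-u = x≤y⇒0≤y-x u≤v
      0≤δ = ≤-trans 0≤v-u (mesh zero)
      unit-s : Unit s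
      unit-s = ≤-trans (Unit.0≤t (unit zero)) (lo zero) , ≤-trans (hi zero) (Unit.t≤1 (unit (suc zero)))
      neg≤ : ∀ {x y z} → 0ℝ ≤ x - y → 0ℝ ≤ z → y - x ≤ z
      neg≤ {x} {y} {z} h k = 0≤y-x⇒x≤y (≤-resp ≃-refl
        (solve 3 (λ x y z → (x :- y) :+ z := z :- (y :- x)) ≃-refl x y z) (0≤+ h k))
      -[v-u]≤ : - (v - u) ≤ v - u
      -[v-u]≤ = ≤-resp (solve 2 (λ u v → u :- v := :- (v :- u)) ≃-refl u v) ≃-refl (neg≤ 0≤v-u 0≤v-u)
      u-s : ∣ u - s ∣ ≤ δ
      u-s = ∣x∣≤ (neg≤ (x≤y⇒0≤y-x (lo zero)) 0≤δ)
        (≤-trans (≤-resp (solve 2 (λ s u → s :- u := :- (u :- s)) ≃-refl s u) ≃-refl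
          (+-mono-≤ (hi zero) (≤-refl { - u}))) (mesh zero))
      v-s : ∣ v - s ∣ ≤ δ
      v-s = ∣x∣≤
        (≤-trans (0≤y-x⇒x≤y (≤-resp ≃-refl
          (solve 3 (λ s u v → s :- u := (v :- u) :- (v :- s)) ≃-refl s u v) (x≤y⇒0≤y-x (lo zero)))) (mesh zero))
        (≤-resp (solve 2 (λ s v → s :- v := :- (v :- s)) ≃-refl s v) ≃-refl
          (neg≤ (x≤y⇒0≤y-x (hi zero)) 0≤δ))

  F-cong : ∀ {F f} → Antiderivative F f → ∀ {u v} → Unit u → Unit v → u ≃ v → F u ≃ F v
  F-cong {F} D {u} {v} i j e = x-y≃0⇒x≃y (∣x∣≤0⇒x≃0 (≤-trans (F-lipschitz D i j)
    (≤-trans (*-monoˡ-≤ (0≤K D) (∣0∣≤ u-v≃0 0≤0))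
      (≤-reflexive (solve 1 (λ k → k :* con 0ℚ := con 0ℚ) ≃-refl (K D))))))
    where
    u-v≃0 : u - v ≃ 0ℝ
    u-v≃0 = ≃-trans (+-cong e (≃-refl { - v})) (solve 1 (λ v → v :- v := con 0ℚ) ≃-refl v)

  fundamental : ∀ {F f} → Antiderivative F f → IsIntegral f 0ℝ 1ℝ (F 1ℝ - F 0ℝ)
  fundamental {F} {f} D ε ε>0 =
    let Q , Q>0 , M≤Q = archimedean (M D)
        δ , δ>0 , Qδ = divide ε>0 Q>0
    in δ , δ>0 , λ P mesh →
      let open TaggedPartition P
          mono = λ i → ≤-trans (tag-lower i) (tag-upper i)
          unit : ∀ i → Unit (point i)
          unit i = let l , r = chain size point mono i in
            ≤-trans (≤-reflexive (≃-sym start)) l , ≤-trans r (≤-reflexive end)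
          unit₀ = ≤-refl , fromℚ-mono-≤ (ℚ.<⇒≤ 1>0)
          unit₁ = fromℚ-mono-≤ (ℚ.<⇒≤ 1>0) , ≤-refl
      in ≤-trans
        (≤-trans
          (≤-reflexive (≃-trans
            (∣∣-cong (solve 3 (λ s x y → s :- (x :- y) := :- ((x :- y) :- s)) ≃-refl (riemannSum f) (F 1ℝ) (F 0ℝ)))
            (∣-x∣≃∣x∣ _)))
          (∣∣≤-resp
            (+-cong (+-cong (F-cong D (unit _) unit₁ end) (-‿cong (F-cong D (unit _) unit₀ start)))
              (≃-refl { - riemannSum f}))
            (≃-trans (*-cong ≃-refl (+-cong end (-‿cong start)))
              (solve 2 (λ m d → (m :* d) :* (con 1ℚ :- con 0ℚ) := d :* m) ≃-refl (M D) (fromℚ δ)))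
            (telescope D size point tag unit tag-lower tag-upper mesh)))
        (≤-resp ≃-refl (≃-trans (*-comm (fromℚ δ) (fromℚ Q)) (≡⇒≃ λ _ → Qδ))
          (*-monoˡ-≤ (fromℚ-mono-≤ (ℚ.<⇒≤ δ>0)) (≤-trans (x≤∣x∣ (M D)) M≤Q)))

  -- The factor t ^ k makes this class closed under multiplication by t, so
  -- that products of linear factors can be handled by induction.

  Good : (ℝ → ℝ) → Set
  Good f = ∀ k → ∃ λ F → Antiderivative F (λ t → t ^ k * f t)

  good-integrable : ∀ {f} → Good f → Integrable f 0ℝ 1ℝ
  good-integrable {f} g = let F , D = g 0 in
    F 1ℝ - F 0ℝ , fundamental (resp (λ _ → ≃-refl) (λ t → solve 1 (λ x → con 1ℚ :* x := x) ≃-refl (f t)) D)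

  good-resp : ∀ {f g} → (∀ t → f t ≃ g t) → Good f → Good g
  good-resp e h k = let F , D = h k in
    F , resp (λ _ → ≃-refl) (λ t → *-cong ≃-refl (e t)) D

  private
    monomial : ∀ k → ∃ λ q → 0ℚ ℚ.< q × Antiderivative (λ t → t ^ suc k) (λ t → fromℚ q * t ^ k)
    monomial zero = 1ℚ , 1>0 , resp (λ _ → ≃-refl)
      (λ t → solve 1 (λ t → con 1ℚ :+ t :* con 0ℚ := con 1ℚ :* con 1ℚ) ≃-refl t) (times-t (constant 1ℝ))
    monomial (suc k) = let q , q>0 , D = monomial k in
      1ℚ ℚ.+ q , ℚ.+-mono-< 1>0 q>0 , resp (λ _ → ≃-refl)
        (λ t → ≃-trans
          (solve 3 (λ t q p → t :* p :+ t :* (q :* p) := (con 1ℚ :+ q) :* (t :* p)) ≃-refl t (fromℚ q) (t ^ k))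
          (*-cong (≡⇒≃ λ _ → ≡.refl) ≃-refl))
        (times-t D)

  good-constant : ∀ c → Good (λ _ → c)
  good-constant c k =
    let q , q>0 , D = monomial k
        r , _ , qr = divide 1>0 q>0
    in (λ t → (c * fromℚ r) * t ^ suc k) , resp (λ _ → ≃-refl)
      (λ t → ≃-trans
        (solve 4 (λ c r q p → (c :* r) :* (q :* p) := (q :* r) :* (p :* c)) ≃-refl c (fromℚ r) (fromℚ q) (t ^ k))
        (≃-trans (*-cong {y = t ^ k * c} (≡⇒≃ {y = 1ℝ} λ _ → qr) ≃-refl)
          (solve 1 (λ x → con 1ℚ :* x := x) ≃-refl (t ^ k * c))))
      (scale (c * fromℚ r) D)

  good-scale : ∀ {f} c → Good f → Good (λ t → c * f t)
  good-scale {f} c h k = let F , D = h k in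
    (λ t → c * F t) , resp (λ _ → ≃-refl)
      (λ t → solve 3 (λ c p x → c :* (p :* x) := p :* (c :* x)) ≃-refl c (t ^ k) (f t)) (scale c D)

  good-times : ∀ {f} c → Good f → Good (λ t → f t * (c - t))
  good-times {f} c h k =
    let F , D = h k
        G , E = h (suc k)
    in (λ t → c * F t + fromℚ (ℚ.- 1ℚ) * G t) , resp (λ _ → ≃-refl)
      (λ t → solve 4 (λ c t p x → c :* (p :* x) :+ con (ℚ.- 1ℚ) :* ((t :* p) :* x) := p :* (x :* (c :- t)))
        ≃-refl c t (t ^ k) (f t))
      (add (scale c D) (scale (fromℚ (ℚ.- 1ℚ)) E))

fromℕ : ℕ → ℝ
fromℕ n = fromℚ (+ n ℚ./ 1)

infixl 7 _÷_

_÷_ : ℝ → (k : ℕ) .{{_ : ℕ.NonZero k}} → ℝ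
x ÷ k = x * fromℚ (+ 1 ℚ./ k)

fallingFactorial : ℝ → ℕ → ℝ
fallingFactorial z zero    = 1ℝ
fallingFactorial z (suc n) = fallingFactorial z n * (z - fromℕ n)

binom : ℝ → ℕ → ℝ
binom z n = (fallingFactorial z n ÷ n !) {{n !≢0}}

-- abstract: the integral is to be used only through IsIntegral.
abstract
  binom-integrable : ∀ x n → Integrable (λ t → binom (x - t) n) 0ℝ 1ℝ
  binom-integrable x n = good-integrable
    (good-resp (λ t → *-comm 1/n! _) (good-scale 1/n! (falling n)))
    where
    1/n! : ℝ
    1/n! = fromℚ ((+ 1 ℚ./ n !) {{n !≢0}})
    open ℝ-Solver
    falling : ∀ n → Good (λ t → fallingFactorial (x - t) n)
    falling zero    = good-constant 1ℝ
    falling (suc n) = good-resp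
      (λ t → *-cong (≃-refl {fallingFactorial (x - t) n})
        (solve 3 (λ x k t → (x :- k) :- t := (x :- t) :- k) ≃-refl x (fromℕ n) t))
      (good-times (x - fromℕ n) (falling n))

ĉ : ℕ → ℝ → ℝ
ĉ n x = fromℕ (n !) * ∫ (λ t → binom (x - t) n) 0ℝ 1ℝ (binom-integrable x n)

denominator≢0 : ∀ {n} (m : Fin n) → ℕ.NonZero ((n ∸ toℕ m) ℕ.* (suc n ∸ toℕ m))
denominator≢0 {n} m = ℕ.m*n≢0 (n ∸ toℕ m) (suc n ∸ toℕ m)
  where
  instance
    _ = ℕ.>-nonZero (ℕ.m<n⇒0<n∸m (Fin.toℕ<n m))
    _ = ℕ.>-nonZero (ℕ.m<n⇒0<n∸m (ℕ.m<n⇒m<1+n (Fin.toℕ<n m)))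

{-# OPTIONS --safe #-}

-- Put I n = ∫₀¹ binom (x - t) n dt = ĉ n x / n !.  Differentiating (1 + u)^z in z
-- multiplies it by ln (1 + u), so d/dz binom z n = Σ_{m<n} (-1)^(n-1-m) / (n-m) · binom z m.
-- Adding this for n + 1 and n and using 1/(k+1) - 1/k = -1/(k(k+1)) gives
--   d/dz (binom z (n+1) + binom z n) = binom z n - Σ_{m<n} (-1)^(n-m) / ((n-m)(n+1-m)) · binom z m.
-- Integrating over z = x - t, t ∈ [0, 1], the left-hand side becomes, by Pascal's rule
-- binom x (n+1) = binom (x-1) (n+1) + binom (x-1) n, equal to binom x n.

module Submission where

open import Algebra.Bundles using (CommutativeRing)
import Algebra.Properties.Semiring.Sum as SemiringSum
open import Data.Fin.Base as Fin using (Fin; zero; suc; toℕ; inject₁)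
import Data.Fin.Properties as Fin
open import Data.Integer.Base as ℤ using (+_; +[1+_])
import Data.Integer.Properties as ℤ
open import Data.Nat.Base as ℕ using (ℕ; zero; suc; _∸_; _!)
import Data.Nat.Properties as ℕ
open import Data.Nat.Properties using (_!≢0)
open import Data.Product using (∃; _,_; proj₁; proj₂)
open import Data.Rational as ℚ using (ℚ; mkℚ; 0ℚ; 1ℚ; ½)
import Data.Rational.Properties as ℚ
open import Data.Rational.Unnormalised.Base as ℚᵘ using (mkℚᵘ; *≡*; *≤*)
import Data.Rational.Unnormalised.Properties as ℚᵘ
open import Data.Sum.Base using (inj₁; inj₂)
open import Function.Base using (_∘_)
open import Relation.Binary.PropositionalEquality as ≡ using (_≡_)
import Relation.Binary.Reasoning.Setoid as SetoidReasoning
open import Defs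

open SemiringSum (CommutativeRing.semiring ℝ-commutativeRing)
  using (sum-cong-≋; ∑-distrib-+; *-distribʳ-sum)
open SetoidReasoning (CommutativeRing.setoid ℝ-commutativeRing)
open ℝ-Solver

private
  variable
    n : ℕ
    x y : ℝ
    f F : ℝ → ℝ

-- Natural numbers and their reciprocals as reals

-- `ℚ._/_` normalises and so does not compute at variables; the arithmetic of `fromℕ` and `recip` is
-- therefore transported from unnormalised rationals.
fromℚᵘ-homo-+ : ∀ p q → ℚ.fromℚᵘ (p ℚᵘ.+ q) ≡ ℚ.fromℚᵘ p ℚ.+ ℚ.fromℚᵘ q
fromℚᵘ-homo-+ p q = ℚ.toℚᵘ-injective (ℚᵘ.≃-trans (ℚ.toℚᵘ-fromℚᵘ (p ℚᵘ.+ q)) (ℚᵘ.≃-sym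
  (ℚᵘ.≃-trans (ℚ.toℚᵘ-homo-+ (ℚ.fromℚᵘ p) (ℚ.fromℚᵘ q))
    (ℚᵘ.+-cong (ℚ.toℚᵘ-fromℚᵘ p) (ℚ.toℚᵘ-fromℚᵘ q)))))

fromℚᵘ-homo-* : ∀ p q → ℚ.fromℚᵘ (p ℚᵘ.* q) ≡ ℚ.fromℚᵘ p ℚ.* ℚ.fromℚᵘ q
fromℚᵘ-homo-* p q = ℚ.toℚᵘ-injective (ℚᵘ.≃-trans (ℚ.toℚᵘ-fromℚᵘ (p ℚᵘ.* q)) (ℚᵘ.≃-sym
  (ℚᵘ.≃-trans (ℚ.toℚᵘ-homo-* (ℚ.fromℚᵘ p) (ℚ.fromℚᵘ q))
    (ℚᵘ.*-cong (ℚ.toℚᵘ-fromℚᵘ p) (ℚ.toℚᵘ-fromℚᵘ q)))))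

fromℕ-homo-+ : ∀ m n → fromℕ (m ℕ.+ n) ≃ fromℕ m + fromℕ n
fromℕ-homo-+ m n = ≡⇒≃ λ _ → ≡.trans
  (ℚ.fromℚᵘ-cong {mkℚᵘ (+ (m ℕ.+ n)) 0} {mkℚᵘ (+ m) 0 ℚᵘ.+ mkℚᵘ (+ n) 0}
    (*≡* (≡.cong (ℤ._* (+ 1)) (≡.sym (≡.cong₂ ℤ._+_ (ℤ.*-identityʳ (+ m)) (ℤ.*-identityʳ (+ n)))))))
  (fromℚᵘ-homo-+ (mkℚᵘ (+ m) 0) (mkℚᵘ (+ n) 0))

fromℕ-homo-* : ∀ m n → fromℕ (m ℕ.* n) ≃ fromℕ m * fromℕ n
fromℕ-homo-* m n = ≡⇒≃ λ _ → ≡.trans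
  (ℚ.fromℚᵘ-cong {mkℚᵘ (+ (m ℕ.* n)) 0} {mkℚᵘ (+ m) 0 ℚᵘ.* mkℚᵘ (+ n) 0}
    (*≡* (≡.cong (ℤ._* (+ 1)) (ℤ.pos-* m n))))
  (fromℚᵘ-homo-* (mkℚᵘ (+ m) 0) (mkℚᵘ (+ n) 0))

≡⇒≃-at : ∀ (f : ℕ → ℝ) {m n} → m ≡ n → f m ≃ f n
≡⇒≃-at f ≡.refl = ≃-refl

recip : (k : ℕ) .{{_ : ℕ.NonZero k}} → ℝ
recip k = fromℚ (+ 1 ℚ./ k)

recip-inverse : ∀ k .{{_ : ℕ.NonZero k}} → recip k * fromℕ k ≃ 1ℝ
recip-inverse (suc k) = ≡⇒≃ λ _ → ≡.trans
  (≡.sym (fromℚᵘ-homo-* (mkℚᵘ (+ 1) k) (mkℚᵘ (+ suc k) 0)))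
  (ℚ.fromℚᵘ-cong {mkℚᵘ (+ 1) k ℚᵘ.* mkℚᵘ (+ suc k) 0} {ℚᵘ.1ℚᵘ}
    (*≡* (ℤ.*-assoc (+ 1) (+ suc k) (+ 1))))

-- Allows identities with factorial or reciprocal denominators to be proved after clearing those
-- denominators.
*-cancelʳ-fromℕ : ∀ k .{{_ : ℕ.NonZero k}} → x * fromℕ k ≃ y * fromℕ k → x ≃ y
*-cancelʳ-fromℕ {x} {y} k e = begin
  x                        ≈⟨ expand x ⟩
  (x * fromℕ k) * recip k  ≈⟨ *-cong e ≃-refl ⟩
  (y * fromℕ k) * recip k  ≈⟨ expand y ⟨
  y                        ∎
  where
  expand : ∀ z → z ≃ (z * fromℕ k) * recip k
  expand z = begin
    z                        ≈⟨ solve 1 (λ z → z := z :* con 1ℚ) ≃-refl z ⟩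
    z * 1ℝ                   ≈⟨ *-cong (≃-refl {z}) (recip-inverse k) ⟨
    z * (recip k * fromℕ k)  ≈⟨ solve 3 (λ z r k → z :* (r :* k) := (z :* k) :* r) ≃-refl z (recip k) (fromℕ k) ⟩
    (z * fromℕ k) * recip k  ∎

recip-* : ∀ m n .{{_ : ℕ.NonZero m}} .{{_ : ℕ.NonZero n}} .{{_ : ℕ.NonZero (m ℕ.* n)}} →
  recip (m ℕ.* n) ≃ recip m * recip n
recip-* m n = *-cancelʳ-fromℕ (m ℕ.* n) (begin
  recip (m ℕ.* n) * fromℕ (m ℕ.* n)        ≈⟨ recip-inverse (m ℕ.* n) ⟩
  1ℝ                                       ≈⟨ solve 0 (con 1ℚ := con 1ℚ :* con 1ℚ) ≃-refl ⟩
  1ℝ * 1ℝ                                  ≈⟨ *-cong (recip-inverse m) (recip-inverse n) ⟨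
  (recip m * fromℕ m) * (recip n * fromℕ n)
    ≈⟨ solve 4 (λ r a s b → (r :* a) :* (s :* b) := (r :* s) :* (a :* b)) ≃-refl
         (recip m) (fromℕ m) (recip n) (fromℕ n) ⟩
  (recip m * recip n) * (fromℕ m * fromℕ n) ≈⟨ *-cong ≃-refl (fromℕ-homo-* m n) ⟨
  (recip m * recip n) * fromℕ (m ℕ.* n)    ∎)

-- The denominator of `δ` itself serves, because a positive rational has numerator at least 1.
recip-small : ∀ {δ} → 0ℚ ℚ.< δ → ∃ λ k → + 1 ℚ./ suc k ℚ.≤ δ
recip-small {mkℚ (+ 0) _ _} (ℚ.*<* (ℤ.+<+ ()))
recip-small {δ@(mkℚ +[1+ p ] d _)} _ = d , ℚ.toℚᵘ-cancel-≤ (ℚᵘ.≤-trans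
  (ℚᵘ.≤-reflexive (ℚ.toℚᵘ-fromℚᵘ (mkℚᵘ (+ 1) d)))
  (*≤* (ℤ.*-monoʳ-≤-nonNeg (+ suc d) {+ 1} {+ suc p} (ℤ.+≤+ (ℕ.s≤s ℕ.z≤n)))))
recip-small {mkℚ (ℤ.-[1+_] _) _ _} (ℚ.*<* ())

-- Uniqueness of the integral

module UniformPartition (k : ℕ) where
  h : ℝ
  h = recip (suc k)

  node : Fin (suc (suc k)) → ℝ
  node i = fromℕ (toℕ i) * h

  node-suc : ∀ i → node (suc i) ≃ node (inject₁ i) + h
  node-suc i = begin
    fromℕ (suc (toℕ i)) * h   ≈⟨ *-cong (fromℕ-homo-+ 1 (toℕ i)) ≃-refl ⟩
    (1ℝ + fromℕ (toℕ i)) * h  ≈⟨ solve 2 (λ a h → (con 1ℚ :+ a) :* h := a :* h :+ h) ≃-refl (fromℕ (toℕ i)) h ⟩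
    fromℕ (toℕ i) * h + h
      ≈⟨ +-cong (*-cong (≡⇒≃-at fromℕ (Fin.toℕ-inject₁ i)) (≃-refl {h})) (≃-refl {h}) ⟨
    node (inject₁ i) + h      ∎

  width : ∀ i → node (suc i) - node (inject₁ i) ≃ h
  width i = ≃-trans (+-cong (node-suc i) (≃-refl { - node (inject₁ i)}))
    (solve 2 (λ a h → (a :+ h) :- a := h) ≃-refl (node (inject₁ i)) h)

  0≤h : 0ℝ ≤ h
  0≤h = fromℚ-mono-≤ (ℚ.nonNegative⁻¹ (+ 1 ℚ./ suc k) {{ℚ.normalize-nonNeg 1 (suc k)}})

  partition : TaggedPartition 0ℝ 1ℝ
  partition = record
    { size = suc k
    ; point = node
    ; tag = λ i → node (inject₁ i)
    ; start = solve 1 (λ h → con 0ℚ :* h := con 0ℚ) ≃-refl h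
    ; end = begin
        node (Fin.fromℕ (suc k))   ≈⟨ *-cong (≡⇒≃-at fromℕ (Fin.toℕ-fromℕ (suc k))) (≃-refl {h}) ⟩
        fromℕ (suc k) * h          ≈⟨ solve 2 (λ a h → a :* h := h :* a) ≃-refl (fromℕ (suc k)) h ⟩
        h * fromℕ (suc k)          ≈⟨ recip-inverse (suc k) ⟩
        1ℝ                         ∎
    ; tag-lower = λ i → ≤-refl
    ; tag-upper = λ i → 0≤y-x⇒x≤y (≤-resp ≃-refl (≃-sym (width i)) 0≤h)
    }

  mesh : ∀ {δ} → + 1 ℚ./ suc k ℚ.≤ δ → TaggedPartition.mesh≤ partition (fromℚ δ)
  mesh h≤δ i = ≤-trans (≤-reflexive (width i)) (fromℚ-mono-≤ h≤δ)

½*p>0 : ∀ {p} → 0ℚ ℚ.< p → 0ℚ ℚ.< ½ ℚ.* p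
½*p>0 {p} p>0 = ℚ.positive⁻¹ (½ ℚ.* p) {{ℚ.pos*pos⇒pos ½ p {{ℚ.positive p>0}}}}

½*p+½*p≡p : ∀ p → ½ ℚ.* p ℚ.+ ½ ℚ.* p ≡ p
½*p+½*p≡p p = ≡.trans (≡.sym (ℚ.*-distribʳ-+ p ½ ½)) (ℚ.*-identityˡ p)

⊓->0 : ∀ {p q} → 0ℚ ℚ.< p → 0ℚ ℚ.< q → 0ℚ ℚ.< p ℚ.⊓ q
⊓->0 {p} {q} p>0 q>0 with ℚ.⊓-sel p q
... | inj₁ e = ≡.subst (0ℚ ℚ.<_) (≡.sym e) p>0
... | inj₂ e = ≡.subst (0ℚ ℚ.<_) (≡.sym e) q>0

-- Half of the tolerance goes to the hypothesis, the other half to the slack already built into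
-- `_≤_`.
≤-fromℚ⇒≤0 : (∀ ε → 0ℚ ℚ.< ε → x ≤ fromℚ ε) → x ≤ 0ℝ
≤-fromℚ⇒≤0 {x} h = *≤* λ ε ε>0 → bound ε (½*p>0 ε>0) (h _ (½*p>0 ε>0))
  where
  bound : ∀ ε → 0ℚ ℚ.< ½ ℚ.* ε → x ≤ fromℚ (½ ℚ.* ε) → Eventually λ n → seq x n ℚ.≤ 0ℚ ℚ.+ ε
  bound ε ½ε>0 (*≤* k) = let N , p = k _ ½ε>0 in N , λ n N≤n →
    ≡.subst (seq x n ℚ.≤_) (≡.trans (½*p+½*p≡p ε) (≡.sym (ℚ.+-identityˡ ε))) (p n N≤n)

-- A uniform partition finer than both moduli exists, and its single Riemann sum lies within ε/2 of
-- `I` and of `J`.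
integral-unique : ∀ {I J} → IsIntegral f 0ℝ 1ℝ I → IsIntegral f 0ℝ 1ℝ J → I ≃ J
integral-unique {f} {I} {J} p q = x-y≃0⇒x≃y (∣x∣≤0⇒x≃0 (≤-fromℚ⇒≤0 close))
  where
  close : ∀ ε → 0ℚ ℚ.< ε → ∣ I - J ∣ ≤ fromℚ ε
  close ε ε>0 =
    let δ , δ>0 , P = p _ (½*p>0 ε>0)
        η , η>0 , Q = q _ (½*p>0 ε>0)
        k , h≤ = recip-small (⊓->0 δ>0 η>0)
        open UniformPartition k
        S = TaggedPartition.riemannSum partition f
    in ∣∣≤-resp
      (solve 3 (λ s i j → (:- (s :- i)) :+ (s :- j) := i :- j) ≃-refl S I J)
      (≡⇒≃ λ _ → ½*p+½*p≡p ε)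
      (∣x+y∣≤ (≤-trans (≤-reflexive (∣-x∣≃∣x∣ (S - I)))
          (P partition (mesh (ℚ.≤-trans h≤ (ℚ.p⊓q≤p δ η)))))
        (Q partition (mesh (ℚ.≤-trans h≤ (ℚ.p⊓q≤q δ η)))))

-- Binomial coefficients and their derivatives

binom-cong : ∀ n → x ≃ y → binom x n ≃ binom y n
binom-cong {x} {y} n e = *-cong (fallingFactorial-cong n) ≃-refl
  where
  fallingFactorial-cong : ∀ n → fallingFactorial x n ≃ fallingFactorial y n
  fallingFactorial-cong zero    = ≃-refl
  fallingFactorial-cong (suc n) = *-cong (fallingFactorial-cong n) (+-cong e (≃-refl { - fromℕ n}))

binom-zero : ∀ z → binom z 0 ≃ 1ℝ
binom-zero z = solve 0 (con 1ℚ :* con 1ℚ := con 1ℚ) ≃-refl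

-- Division-free ratio of consecutive coefficients; the later inductions on `n` go through it
-- instead of through factorials.
binom-suc : ∀ z n → binom z (suc n) * fromℕ (suc n) ≃ binom z n * (z - fromℕ n)
binom-suc z n = begin
  (ff * w * recip (suc n ℕ.* n !)) * k  ≈⟨ *-cong (*-cong (≃-refl {ff * w}) (recip-* (suc n) (n !))) (≃-refl {k}) ⟩
  (ff * w * (recip (suc n) * r)) * k
    ≈⟨ solve 5 (λ f w s r k → (f :* w :* (s :* r)) :* k := (f :* r :* w) :* (s :* k)) ≃-refl ff w (recip (suc n)) r k ⟩
  (ff * r * w) * (recip (suc n) * k)    ≈⟨ *-cong (≃-refl {ff * r * w}) (recip-inverse (suc n)) ⟩
  (ff * r * w) * 1ℝ                     ≈⟨ solve 1 (λ a → a :* con 1ℚ := a) ≃-refl (ff * r * w) ⟩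
  ff * r * w                            ∎
  where
  instance
    _ = n !≢0
    _ = suc n !≢0
  ff = fallingFactorial z n
  w  = z - fromℕ n
  k  = fromℕ (suc n)
  r  = recip (n !)

-- Induction with the denominator cleared by `binom-suc`. The step rests on (z + 1) - (n + 1) = z -
-- n, after which `binom-suc` read backwards turns `b₀ * (z - N₀)` into `b₁ * N₁`.
pascal : ∀ z n → binom (z + 1ℝ) (suc n) ≃ binom z (suc n) + binom z n
pascal z zero = *-cancelʳ-fromℕ 1 (begin
  binom (z + 1ℝ) 1 * 1ℝ                   ≈⟨ binom-suc (z + 1ℝ) 0 ⟩
  binom (z + 1ℝ) 0 * (z + 1ℝ - 0ℝ)        ≈⟨ *-cong (binom-zero (z + 1ℝ)) ≃-refl ⟩
  1ℝ * (z + 1ℝ - 0ℝ)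
    ≈⟨ solve 1 (λ z → con 1ℚ :* (z :+ con 1ℚ :- con 0ℚ) := con 1ℚ :* (z :- con 0ℚ) :+ con 1ℚ :* con 1ℚ) ≃-refl z ⟩
  1ℝ * (z - 0ℝ) + 1ℝ * 1ℝ
    ≈⟨ +-cong (*-cong (binom-zero z) ≃-refl) (*-cong (binom-zero z) (≃-refl {1ℝ})) ⟨
  binom z 0 * (z - 0ℝ) + binom z 0 * 1ℝ   ≈⟨ +-cong (binom-suc z 0) (≃-refl {binom z 0 * 1ℝ}) ⟨
  binom z 1 * 1ℝ + binom z 0 * 1ℝ
    ≈⟨ solve 2 (λ a b → a :* con 1ℚ :+ b :* con 1ℚ := (a :+ b) :* con 1ℚ) ≃-refl (binom z 1) (binom z 0) ⟩
  (binom z 1 + binom z 0) * 1ℝ            ∎)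
pascal z (suc n) = *-cancelʳ-fromℕ (suc (suc n)) (begin
  binom (z + 1ℝ) (suc (suc n)) * N₂        ≈⟨ binom-suc (z + 1ℝ) (suc n) ⟩
  binom (z + 1ℝ) (suc n) * (z + 1ℝ - N₁)   ≈⟨ *-cong (pascal z n) (+-cong (≃-refl {z + 1ℝ}) (-‿cong N₁≃)) ⟩
  (b₁ + b₀) * (z + 1ℝ - (1ℝ + N₀))
    ≈⟨ solve 4 (λ a b z n → (a :+ b) :* (z :+ con 1ℚ :- (con 1ℚ :+ n)) := a :* (z :- n) :+ b :* (z :- n))
         ≃-refl b₁ b₀ z N₀ ⟩
  b₁ * (z - N₀) + b₀ * (z - N₀)            ≈⟨ +-cong (≃-refl {b₁ * (z - N₀)}) (binom-suc z n) ⟨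
  b₁ * (z - N₀) + b₁ * N₁
    ≈⟨ +-cong (*-cong (≃-refl {b₁}) z-N₀≃) (≃-refl {b₁ * N₁}) ⟩
  b₁ * (z - N₁ + 1ℝ) + b₁ * N₁
    ≈⟨ solve 3 (λ a z n → a :* (z :- n :+ con 1ℚ) :+ a :* n := a :* (z :- n) :+ a :* (con 1ℚ :+ n)) ≃-refl b₁ z N₁ ⟩
  b₁ * (z - N₁) + b₁ * (1ℝ + N₁)
    ≈⟨ +-cong (binom-suc z (suc n)) (*-cong (≃-refl {b₁}) (fromℕ-homo-+ 1 (suc n))) ⟨
  b₂ * N₂ + b₁ * N₂
    ≈⟨ solve 3 (λ a b n → a :* n :+ b :* n := (a :+ b) :* n) ≃-refl b₂ b₁ N₂ ⟩
  (b₂ + b₁) * N₂                           ∎)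
  where
  b₀ = binom z n
  b₁ = binom z (suc n)
  b₂ = binom z (suc (suc n))
  N₀ = fromℕ n
  N₁ = fromℕ (suc n)
  N₂ = fromℕ (suc (suc n))
  N₁≃ : N₁ ≃ 1ℝ + N₀
  N₁≃ = fromℕ-homo-+ 1 n
  z-N₀≃ : z - N₀ ≃ z - N₁ + 1ℝ
  z-N₀≃ = ≃-trans
    (solve 2 (λ z n → z :- n := z :- (con 1ℚ :+ n) :+ con 1ℚ) ≃-refl z N₀)
    (+-cong (+-cong (≃-refl {z}) (-‿cong (≃-sym N₁≃))) (≃-refl {1ℝ}))

-- The index is shifted: this is the coefficient of u^(k+1) in ln (1 + u).
logCoeff : ℕ → ℝ
logCoeff k = (- 1ℝ) ^ k ÷ suc k

logCoeff-cancel : ∀ k → logCoeff k * fromℕ (suc k) ≃ (- 1ℝ) ^ k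
logCoeff-cancel k = begin
  p * recip (suc k) * fromℕ (suc k)
    ≈⟨ solve 3 (λ p r k → p :* r :* k := p :* (r :* k)) ≃-refl p (recip (suc k)) (fromℕ (suc k)) ⟩
  p * (recip (suc k) * fromℕ (suc k))  ≈⟨ *-cong (≃-refl {p}) (recip-inverse (suc k)) ⟩
  p * 1ℝ                               ≈⟨ solve 1 (λ p → p :* con 1ℚ := p) ≃-refl p ⟩
  p                                    ∎
  where p = (- 1ℝ) ^ k

-- The coefficients are those of ln (1 + u), since d/dz (1 + u)^z = ln (1 + u) (1 + u)^z.
binom′ : ℝ → ℕ → ℝ
binom′ z n = sum {n} λ i → logCoeff (n ∸ suc (toℕ i)) * binom z (toℕ i)

sum-last : ∀ (f : ℕ → ℝ) n → sum {suc n} (f ∘ toℕ) ≃ sum {n} (f ∘ toℕ) + f n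
sum-last f zero    = solve 1 (λ a → a :+ con 0ℚ := con 0ℚ :+ a) ≃-refl (f 0)
sum-last f (suc n) = begin
  f 0 + sum {suc n} (f ∘ suc ∘ toℕ)            ≈⟨ +-cong (≃-refl {f 0}) (sum-last (f ∘ suc) n) ⟩
  f 0 + (sum {n} (f ∘ suc ∘ toℕ) + f (suc n))
    ≈⟨ solve 3 (λ a b c → a :+ (b :+ c) := a :+ b :+ c) ≃-refl (f 0) (sum {n} (f ∘ suc ∘ toℕ)) (f (suc n)) ⟩
  f 0 + sum {n} (f ∘ suc ∘ toℕ) + f (suc n)    ∎

n∸i≡suc : (i : Fin n) → n ∸ toℕ i ≡ suc (n ∸ suc (toℕ i))
n∸i≡suc i = ℕ.+-∸-assoc 1 (Fin.toℕ<n i)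

-- The difference n - i is displayed as a successor so that it matches the denominator in
-- `logCoeff`.
fromℕ-split : (i : Fin n) → fromℕ n ≃ fromℕ (toℕ i) + fromℕ (suc (n ∸ suc (toℕ i)))
fromℕ-split {n} i = ≃-trans
  (≡⇒≃-at fromℕ (≡.sym (≡.trans (ℕ.+-suc (toℕ i) _) (ℕ.m+[n∸m]≡n (Fin.toℕ<n i)))))
  (fromℕ-homo-+ (toℕ i) _)

-- What the product rule predicts on differentiating `binom-suc` in z, proved here by pure algebra
-- from the sum defining `binom′`.
binom′-suc : ∀ z n → binom′ z (suc n) * fromℕ (suc n) ≃ binom′ z n * (z - fromℕ n) + binom z n
binom′-suc z n = begin
  binom′ z (suc n) * fromℕ (suc n)
    ≈⟨ *-distribʳ-sum {suc n} (fromℕ (suc n)) (λ i → c (n ∸ toℕ i) * b (toℕ i)) ⟩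
  sum {suc n} (λ i → c (n ∸ toℕ i) * b (toℕ i) * fromℕ (suc n))
    -- In each term n + 1 = i + (n - i + 1): the first summand gives `u`, while the second cancels
    -- the denominator of the logarithm coefficient and leaves the sign in `v`.
    ≈⟨ sum-cong-≋ {suc n} split ⟩
  sum {suc n} (λ i → u (toℕ i) + v (toℕ i))
    ≈⟨ ∑-distrib-+ {suc n} (u ∘ toℕ) (v ∘ toℕ) ⟩
  u 0 + sum {n} (u ∘ suc ∘ toℕ) + sum {suc n} (v ∘ toℕ)
    -- The factor i kills the term of `u` at 0, and `binom-suc` lowers the index of the others; the
    -- top term of `v` is split off to become `b n`.
    ≈⟨ +-cong (+-cong u₀ (sum-cong-≋ {n} u-suc)) (sum-last v n) ⟩
  0ℝ + sum {n} u′ + (sum {n} (v ∘ toℕ) + v n)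
    ≈⟨ +-cong (≃-refl {0ℝ + sum {n} u′}) (+-cong (≃-refl {sum {n} (v ∘ toℕ)}) vₙ) ⟩
  0ℝ + sum {n} u′ + (sum {n} (v ∘ toℕ) + b n)
    ≈⟨ solve 3 (λ p q r → con 0ℚ :+ p :+ (q :+ r) := p :+ q :+ r) ≃-refl (sum {n} u′) (sum {n} (v ∘ toℕ)) (b n) ⟩
  sum {n} u′ + sum {n} (v ∘ toℕ) + b n
    ≈⟨ +-cong (∑-distrib-+ {n} u′ (v ∘ toℕ)) (≃-refl {b n}) ⟨
  sum {n} (λ i → u′ i + v (toℕ i)) + b n
    -- Since (-1)^(n-i) is -(n - i) times the logarithm coefficient, `v` changes the factor z - i of
    -- `u′` into z - i - (n - i) = z - n.
    ≈⟨ +-cong (sum-cong-≋ {n} merge) (≃-refl {b n}) ⟩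
  sum {n} (λ i → c (n ∸ suc (toℕ i)) * b (toℕ i) * (z - fromℕ n)) + b n
    ≈⟨ +-cong (*-distribʳ-sum {n} (z - fromℕ n) (λ i → c (n ∸ suc (toℕ i)) * b (toℕ i))) (≃-refl {b n}) ⟨
  binom′ z n * (z - fromℕ n) + b n ∎
  where
  b = binom z
  c = logCoeff
  u v : ℕ → ℝ
  u i = c (n ∸ i) * (b i * fromℕ i)
  v i = (- 1ℝ) ^ (n ∸ i) * b i
  u′ : Fin n → ℝ
  u′ i = c (n ∸ suc (toℕ i)) * (b (toℕ i) * (z - fromℕ (toℕ i)))

  split : ∀ i → c (n ∸ toℕ i) * b (toℕ i) * fromℕ (suc n) ≃ u (toℕ i) + v (toℕ i)
  split i = begin
    cᵢ * bᵢ * fromℕ (suc n)      ≈⟨ *-cong (≃-refl {cᵢ * bᵢ}) (fromℕ-split i) ⟩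
    cᵢ * bᵢ * (fromℕ (toℕ i) + k)
      ≈⟨ solve 4 (λ c b i k → c :* b :* (i :+ k) := c :* (b :* i) :+ (c :* k) :* b) ≃-refl cᵢ bᵢ (fromℕ (toℕ i)) k ⟩
    u (toℕ i) + cᵢ * k * bᵢ
      ≈⟨ +-cong (≃-refl {u (toℕ i)}) (*-cong (logCoeff-cancel (n ∸ toℕ i)) (≃-refl {bᵢ})) ⟩
    u (toℕ i) + v (toℕ i)        ∎
    where
    cᵢ = c (n ∸ toℕ i)
    bᵢ = b (toℕ i)
    k = fromℕ (suc (n ∸ toℕ i))

  u₀ : u 0 ≃ 0ℝ
  u₀ = solve 2 (λ c b → c :* (b :* con 0ℚ) := con 0ℚ) ≃-refl (c n) (b 0)

  u-suc : ∀ i → u (suc (toℕ i)) ≃ u′ i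
  u-suc i = *-cong (≃-refl {c (n ∸ suc (toℕ i))}) (binom-suc z (toℕ i))

  vₙ : v n ≃ b n
  vₙ = ≃-trans (*-cong (≡⇒≃-at ((- 1ℝ) ^_) (ℕ.n∸n≡0 n)) (≃-refl {b n}))
    (solve 1 (λ b → con 1ℚ :* b := b) ≃-refl (b n))

  merge : ∀ i → u′ i + v (toℕ i) ≃ c (n ∸ suc (toℕ i)) * b (toℕ i) * (z - fromℕ n)
  merge i = begin
    u′ i + (- 1ℝ) ^ (n ∸ toℕ i) * bᵢ
      ≈⟨ +-cong (≃-refl {u′ i}) (*-cong (≡⇒≃-at ((- 1ℝ) ^_) (n∸i≡suc i)) (≃-refl {bᵢ})) ⟩
    u′ i + - 1ℝ * (- 1ℝ) ^ k * bᵢ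
      ≈⟨ +-cong (≃-refl {u′ i}) (*-cong (*-cong (≃-refl { - 1ℝ}) (logCoeff-cancel k)) (≃-refl {bᵢ})) ⟨
    u′ i + - 1ℝ * (cᵢ * K) * bᵢ
      ≈⟨ solve 5 (λ c b z i k → c :* (b :* (z :- i)) :+ (:- con 1ℚ) :* (c :* k) :* b := c :* b :* (z :- (i :+ k)))
           ≃-refl cᵢ bᵢ z (fromℕ (toℕ i)) K ⟩
    cᵢ * bᵢ * (z - (fromℕ (toℕ i) + K))
      ≈⟨ *-cong (≃-refl {cᵢ * bᵢ}) (+-cong (≃-refl {z}) (-‿cong (fromℕ-split i))) ⟨
    cᵢ * bᵢ * (z - fromℕ n)     ∎
    where
    k = n ∸ suc (toℕ i)
    K = fromℕ (suc k)
    cᵢ = c k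
    bᵢ = b (toℕ i)

-- Integrating the derivative

times-linear : ∀ c → Antiderivative F f → Antiderivative (λ t → F t * (c - t)) (λ t → f t * (c - t) - F t)
times-linear {F} {f} c D = resp
  (λ t → solve 3 (λ c t a → c :* a :+ con (ℚ.- 1ℚ) :* (t :* a) := a :* (c :- t)) ≃-refl c t (F t))
  (λ t → solve 4 (λ c t a b → c :* b :+ con (ℚ.- 1ℚ) :* (a :+ t :* b) := b :* (c :- t) :- a) ≃-refl c t (F t) (f t))
  (add (scale c D) (scale (fromℚ (ℚ.- 1ℚ)) (times-t D)))

sum-antiderivative : ∀ n {F f : Fin n → ℝ → ℝ} → (∀ i → Antiderivative (F i) (f i)) →
  Antiderivative (λ t → sum λ i → F i t) (λ t → sum λ i → f i t)
sum-antiderivative zero    D = constant 0ℝ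
sum-antiderivative (suc n) D = add (D zero) (sum-antiderivative n (D ∘ suc))

sum-distrib-- : ∀ n (f g : Fin n → ℝ) → sum f - sum g ≃ sum (λ i → f i - g i)
sum-distrib-- zero    f g = solve 0 (con 0ℚ :- con 0ℚ := con 0ℚ) ≃-refl
sum-distrib-- (suc n) f g = ≃-trans
  (solve 4 (λ a b c d → (a :+ b) :- (c :+ d) := (a :- c) :+ (b :- d)) ≃-refl
    (f zero) (sum (f ∘ suc)) (g zero) (sum (g ∘ suc)))
  (+-cong (≃-refl {f zero - g zero}) (sum-distrib-- n (f ∘ suc) (g ∘ suc)))

-- The sign is the inner derivative of x - t. Inductively, the product rule differentiates the
-- right-hand side of `binom-suc`, and `binom′-suc` identifies the outcome; this is what makes
-- `binom′` a derivative.
binom-antiderivative : ∀ x n → Antiderivative (λ t → binom (x - t) n) (λ t → - binom′ (x - t) n)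
binom-antiderivative x zero = resp (λ _ → ≃-refl)
  (λ _ → solve 0 (con 0ℚ := :- con 0ℚ) ≃-refl) (constant (binom x 0))
binom-antiderivative x (suc n) = resp value slope
  (scale (recip (suc n)) (times-linear (x - fromℕ n) (binom-antiderivative x n)))
  where
  N = fromℕ (suc n)
  r = recip (suc n)

  recip-solve : ∀ {a b} → b * N ≃ a → r * a ≃ b
  recip-solve {a} {b} e = begin
    r * a        ≈⟨ *-cong (≃-refl {r}) e ⟨
    r * (b * N)  ≈⟨ solve 3 (λ r b n → r :* (b :* n) := b :* (r :* n)) ≃-refl r b N ⟩
    b * (r * N)  ≈⟨ *-cong (≃-refl {b}) (recip-inverse (suc n)) ⟩
    b * 1ℝ       ≈⟨ solve 1 (λ b → b :* con 1ℚ := b) ≃-refl b ⟩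
    b            ∎

  value : ∀ t → r * (binom (x - t) n * (x - fromℕ n - t)) ≃ binom (x - t) (suc n)
  value t = recip-solve (≃-trans (binom-suc (x - t) n)
    (solve 4 (λ b x t n → b :* (x :- t :- n) := b :* (x :- n :- t)) ≃-refl (binom (x - t) n) x t (fromℕ n)))

  slope : ∀ t → r * (- binom′ (x - t) n * (x - fromℕ n - t) - binom (x - t) n) ≃ - binom′ (x - t) (suc n)
  slope t = recip-solve (begin
    - binom′ (x - t) (suc n) * N
      ≈⟨ solve 2 (λ d n → (:- d) :* n := :- (d :* n)) ≃-refl (binom′ (x - t) (suc n)) N ⟩
    - (binom′ (x - t) (suc n) * N)  ≈⟨ -‿cong (binom′-suc (x - t) n) ⟩
    - (binom′ (x - t) n * (x - t - fromℕ n) + binom (x - t) n)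
      ≈⟨ solve 5 (λ d b x t n → :- (d :* (x :- t :- n) :+ b) := (:- d) :* (x :- n :- t) :- b)
           ≃-refl (binom′ (x - t) n) (binom (x - t) n) x t (fromℕ n) ⟩
    - binom′ (x - t) n * (x - fromℕ n - t) - binom (x - t) n ∎)

-- `binom-integrable` is abstract and exposes only a value, so antiderivatives of the integrands are
-- constructed anew, following `binom-suc`.
binom-good : ∀ x n → Good (λ t → binom (x - t) n)
binom-good x zero    = good-constant (binom x 0)
binom-good x (suc n) = good-resp
  (λ t → *-cancelʳ-fromℕ (suc n) (begin
    r * (b t * (x - fromℕ n - t)) * fromℕ (suc n)
      ≈⟨ solve 6 (λ r b x n t k → r :* (b :* (x :- n :- t)) :* k := (r :* k) :* (b :* (x :- t :- n)))
           ≃-refl r (b t) x (fromℕ n) t (fromℕ (suc n)) ⟩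
    r * fromℕ (suc n) * (b t * (x - t - fromℕ n))
      ≈⟨ *-cong (recip-inverse (suc n)) (≃-sym (binom-suc (x - t) n)) ⟩
    1ℝ * (binom (x - t) (suc n) * fromℕ (suc n))
      ≈⟨ solve 1 (λ a → con 1ℚ :* a := a) ≃-refl (binom (x - t) (suc n) * fromℕ (suc n)) ⟩
    binom (x - t) (suc n) * fromℕ (suc n) ∎))
  (good-scale r (good-times (x - fromℕ n) (binom-good x n)))
  where
  r = recip (suc n)
  b = λ t → binom (x - t) n

-- The coefficients of the recurrence

weight : ∀ n (m : Fin n) → ℝ
weight n m = ((- 1ℝ) ^ (n ∸ toℕ m) ÷ ((n ∸ toℕ m) ℕ.* (suc n ∸ toℕ m))) {{denominator≢0 m}}

-- Partial fractions: with k = n - m - 1, the sum is (-1)^k (1/(k+1) - 1/(k+2) - 1/((k+1)(k+2))).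
logCoeff-weight : ∀ (m : Fin n) → logCoeff (n ∸ toℕ m) + logCoeff (n ∸ suc (toℕ m)) + weight n m ≃ 0ℝ
logCoeff-weight {n} m = begin
  logCoeff (n ∸ toℕ m) + logCoeff k + weight n m
    ≈⟨ +-cong (+-cong (≡⇒≃-at logCoeff (n∸i≡suc m)) (≃-refl {logCoeff k})) weight≃ ⟩
  - 1ℝ * p * r₂ + p * r₁ + - 1ℝ * p * (r₁ * r₂)
    -- The factors `1ℝ` are kept as places for `r₂ * (1ℝ + K)` and `r₁ * K`, which bring everything
    -- over the common denominator.
    ≈⟨ solve 3 (λ p r s → (:- con 1ℚ) :* p :* s :+ p :* r :+ (:- con 1ℚ) :* p :* (r :* s)
                  := p :* (r :* con 1ℚ :- s :* con 1ℚ :- r :* s)) ≃-refl p r₁ r₂ ⟩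
  p * (r₁ * 1ℝ - r₂ * 1ℝ - r₁ * r₂)
    ≈⟨ *-cong (≃-refl {p}) (+-cong (+-cong
         (*-cong (≃-refl {r₁}) (≃-trans (*-cong (≃-refl {r₂}) (≃-sym (fromℕ-homo-+ 1 (suc k)))) (recip-inverse (suc (suc k)))))
         (-‿cong (*-cong (≃-refl {r₂}) (recip-inverse (suc k))))) (≃-refl { - (r₁ * r₂)})) ⟨
  p * (r₁ * (r₂ * (1ℝ + K)) - r₂ * (r₁ * K) - r₁ * r₂)
    ≈⟨ solve 4 (λ p r s k → p :* (r :* (s :* (con 1ℚ :+ k)) :- s :* (r :* k) :- r :* s) := con 0ℚ) ≃-refl p r₁ r₂ K ⟩
  0ℝ ∎
  where
  k = n ∸ suc (toℕ m)
  p = (- 1ℝ) ^ k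
  K = fromℕ (suc k)
  r₁ = recip (suc k)
  r₂ = recip (suc (suc k))

  -- With `a` and `b` as variables, matching on `≡.refl` rewrites the exponent, the denominator and
  -- the dependent `NonZero` instance at once.
  signed-recip-* : ∀ {a b} .{{_ : ℕ.NonZero (a ℕ.* b)}} → a ≡ suc k → b ≡ suc (suc k) →
    (- 1ℝ) ^ a ÷ (a ℕ.* b) ≃ - 1ℝ * p * (r₁ * r₂)
  signed-recip-* ≡.refl ≡.refl = *-cong (≃-refl { - 1ℝ * p}) (recip-* (suc k) (suc (suc k)))

  weight≃ : weight n m ≃ - 1ℝ * p * (r₁ * r₂)
  weight≃ = signed-recip-* {{denominator≢0 m}} (n∸i≡suc m)
    (≡.trans (ℕ.+-∸-assoc 1 (ℕ.<⇒≤ (Fin.toℕ<n m))) (≡.cong suc (n∸i≡suc m)))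

-- For m < n the three coefficients of `binom z m` cancel by `logCoeff-weight`. Only the top term of
-- `binom′ z (suc n)` survives, with coefficient `logCoeff 0`, which equals 1.
binom-expansion : ∀ z n → binom′ z (suc n) + binom′ z n + sum {n} (λ m → weight n m * binom z (toℕ m)) ≃ binom z n
binom-expansion z n = begin
  binom′ z (suc n) + binom′ z n + sum {n} w
    ≈⟨ +-cong (+-cong (sum-last (λ i → c (n ∸ i) * b i) n) (≃-refl {binom′ z n})) (≃-refl {sum {n} w}) ⟩
  sum {n} u + c (n ∸ n) * b n + sum {n} v + sum {n} w
    ≈⟨ solve 4 (λ p q r s → p :+ q :+ r :+ s := (p :+ r :+ s) :+ q) ≃-refl
         (sum {n} u) (c (n ∸ n) * b n) (sum {n} v) (sum {n} w) ⟩
  (sum {n} u + sum {n} v + sum {n} w) + c (n ∸ n) * b n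
    ≈⟨ +-cong (≃-trans (∑-distrib-+ {n} (λ i → u i + v i) w)
         (+-cong (∑-distrib-+ {n} u v) (≃-refl {sum {n} w})))
         (*-cong (≡⇒≃-at c (≡.sym (ℕ.n∸n≡0 n))) (≃-refl {b n})) ⟨
  sum {n} (λ i → u i + v i + w i) + c 0 * b n
    ≈⟨ +-cong (sum-cong-≋ {n} cancel) (≃-refl {c 0 * b n}) ⟩
  sum {n} (λ i → b (toℕ i) * 0ℝ) + c 0 * b n
    ≈⟨ +-cong (*-distribʳ-sum {n} 0ℝ (b ∘ toℕ)) (≃-refl {c 0 * b n}) ⟨
  sum {n} (b ∘ toℕ) * 0ℝ + c 0 * b n
    ≈⟨ solve 2 (λ s b → s :* con 0ℚ :+ con 1ℚ :* con 1ℚ :* b := b) ≃-refl (sum {n} (b ∘ toℕ)) (b n) ⟩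
  b n ∎
  where
  b = binom z
  c = logCoeff
  u v w : Fin n → ℝ
  u i = c (n ∸ toℕ i) * b (toℕ i)
  v i = c (n ∸ suc (toℕ i)) * b (toℕ i)
  w i = weight n i * b (toℕ i)
  cancel : ∀ i → u i + v i + w i ≃ b (toℕ i) * 0ℝ
  cancel i = ≃-trans
    (solve 4 (λ b p q r → p :* b :+ q :* b :+ r :* b := b :* (p :+ q :+ r)) ≃-refl
      (b (toℕ i)) (c (n ∸ toℕ i)) (c (n ∸ suc (toℕ i))) (weight n i))
    (*-cong (≃-refl {b (toℕ i)}) (logCoeff-weight i))

-- The recurrence for the integrals

∫binom : ℕ → ℝ → ℝ
∫binom n x = ∫ (λ t → binom (x - t) n) 0ℝ 1ℝ (binom-integrable x n)

-- Uniqueness lets any antiderivative evaluate the opaque integral, so two different ones may be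
-- compared.
∫binom-fundamental : ∀ x n → Antiderivative F (λ t → binom (x - t) n) → ∫binom n x ≃ F 1ℝ - F 0ℝ
∫binom-fundamental x n D = integral-unique {f = λ t → binom (x - t) n} (proj₂ (binom-integrable x n)) (fundamental D)

-- Instead of invoking linearity of the integral, a second antiderivative of the integrand is
-- assembled from `binom-expansion`, and its increment over [0, 1] is computed term by term.
∫binom-recurrence : ∀ x n → ∫binom n x ≃ binom x n + sum {n} (λ m → ∫binom (toℕ m) x * weight n m)
∫binom-recurrence x n = begin
  ∫binom n x
    ≈⟨ ∫binom-fundamental x n antiderivative ⟩
  m1 * (A 1ℝ + B 1ℝ) + S 1ℝ - (m1 * (A 0ℝ + B 0ℝ) + S 0ℝ)
    ≈⟨ solve 6 (λ a b s a′ b′ s′ →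
           con (ℚ.- 1ℚ) :* (a :+ b) :+ s :- (con (ℚ.- 1ℚ) :* (a′ :+ b′) :+ s′)
           := a′ :+ b′ :- (a :+ b) :+ (s :- s′))
         ≃-refl (A 1ℝ) (B 1ℝ) (S 1ℝ) (A 0ℝ) (B 0ℝ) (S 0ℝ) ⟩
  A 0ℝ + B 0ℝ - (A 1ℝ + B 1ℝ) + (S 1ℝ - S 0ℝ)
    -- The endpoint t = 0 contributes both binomials at x; at t = 1 Pascal's rule merges them into
    -- `binom x (suc n)`, which then cancels.
    ≈⟨ +-cong (+-cong (+-cong (binom-cong (suc n) x-0) (binom-cong n x-0)) (-‿cong A+B)) sums ⟩
  binom x (suc n) + binom x n - binom x (suc n) + R
    ≈⟨ solve 3 (λ a b r → a :+ b :- a :+ r := b :+ r) ≃-refl (binom x (suc n)) (binom x n) R ⟩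
  binom x n + R ∎
  where
  m1 = fromℚ (ℚ.- 1ℚ)
  A B : ℝ → ℝ
  A t = binom (x - t) (suc n)
  B t = binom (x - t) n
  G : ℕ → ℝ → ℝ
  -- `Good` is used at exponent 0, so the integrand carries only a trivial factor t^0.
  G m = proj₁ (binom-good x m 0)
  G-antiderivative : ∀ m → Antiderivative (G m) (λ t → binom (x - t) m)
  G-antiderivative m = resp (λ _ → ≃-refl)
    (λ t → solve 1 (λ b → con 1ℚ :* b := b) ≃-refl (binom (x - t) m)) (proj₂ (binom-good x m 0))
  S : ℝ → ℝ
  S t = sum {n} λ m → weight n m * G (toℕ m) t
  R = sum {n} λ m → ∫binom (toℕ m) x * weight n m

  -- The factor `m1` undoes the sign from differentiating x - t; `S` accounts for the weighted sum
  -- in `binom-expansion`.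
  antiderivative : Antiderivative (λ t → m1 * (A t + B t) + S t) B
  antiderivative = resp (λ _ → ≃-refl)
    (λ t → ≃-trans
      (solve 3 (λ a b s → con (ℚ.- 1ℚ) :* (:- a :+ :- b) :+ s := a :+ b :+ s) ≃-refl
        (binom′ (x - t) (suc n)) (binom′ (x - t) n) (sum {n} λ m → weight n m * binom (x - t) (toℕ m)))
      (binom-expansion (x - t) n))
    (add (scale m1 (add (binom-antiderivative x (suc n)) (binom-antiderivative x n)))
      (sum-antiderivative n λ m → scale (weight n m) (G-antiderivative (toℕ m))))

  x-0 : x - 0ℝ ≃ x
  x-0 = solve 1 (λ x → x :- con 0ℚ := x) ≃-refl x

  A+B : A 1ℝ + B 1ℝ ≃ binom x (suc n)
  A+B = ≃-trans (≃-sym (pascal (x - 1ℝ) n))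
    (binom-cong (suc n) (solve 1 (λ x → x :- con 1ℚ :+ con 1ℚ := x) ≃-refl x))

  sums : S 1ℝ - S 0ℝ ≃ R
  sums = ≃-trans (sum-distrib-- n _ _) (sum-cong-≋ {n} λ m → begin
    weight n m * G (toℕ m) 1ℝ - weight n m * G (toℕ m) 0ℝ
      ≈⟨ solve 3 (λ w a b → w :* a :- w :* b := (a :- b) :* w) ≃-refl (weight n m) (G (toℕ m) 1ℝ) (G (toℕ m) 0ℝ) ⟩
    (G (toℕ m) 1ℝ - G (toℕ m) 0ℝ) * weight n m
      ≈⟨ *-cong (∫binom-fundamental x (toℕ m) (G-antiderivative (toℕ m))) (≃-refl {weight n m}) ⟨
    ∫binom (toℕ m) x * weight n m ∎)

ĉ÷! : ∀ n x → (ĉ n x ÷ n !) {{n !≢0}} ≃ ∫binom n x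
ĉ÷! n x = begin
  fromℕ (n !) * ∫binom n x * r
    ≈⟨ solve 3 (λ k i r → k :* i :* r := i :* (r :* k)) ≃-refl (fromℕ (n !)) (∫binom n x) r ⟩
  ∫binom n x * (r * fromℕ (n !))  ≈⟨ *-cong (≃-refl {∫binom n x}) (recip-inverse (n !)) ⟩
  ∫binom n x * 1ℝ                 ≈⟨ solve 1 (λ i → i :* con 1ℚ := i) ≃-refl (∫binom n x) ⟩
  ∫binom n x                      ∎
  where
  instance _ = n !≢0
  r = recip (n !)

mainTheorem1 : ∀ (n : ℕ) → n ℕ.≥ 1 → ∀ (x : ℝ) →
    (ĉ n x ÷ n !) {{n !≢0}}
      ≃ binom x n
        + sum {n} (λ m →
            (ĉ (toℕ m) x ÷ toℕ m !) {{toℕ m !≢0}}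
              * ((- 1ℝ) ^ (n ∸ toℕ m) ÷ ((n ∸ toℕ m) ℕ.* (suc n ∸ toℕ m))) {{denominator≢0 m}})
mainTheorem1 n _ x = begin
  (ĉ n x ÷ n !) {{n !≢0}}                                     ≈⟨ ĉ÷! n x ⟩
  ∫binom n x                                                  ≈⟨ ∫binom-recurrence x n ⟩
  binom x n + sum {n} (λ m → ∫binom (toℕ m) x * weight n m)
    ≈⟨ +-cong (≃-refl {binom x n}) (sum-cong-≋ {n} λ m → *-cong (ĉ÷! (toℕ m) x) (≃-refl {weight n m})) ⟨
  binom x n + sum {n} (λ m → (ĉ (toℕ m) x ÷ toℕ m !) {{toℕ m !≢0}} * weight n m) ∎
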